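{- No model $\mathcal{M}$ of $\mathsf{ZF}$ has a proper end extension $\mathcal{N}$ satisfying $\mathsf{ZF}$ such that $\mathcal{N}$ is a conservative extension of $\mathcal{M}$.
   Context: $\mathcal{N}$ is an end extension of $\mathcal{M}$ if $\mathcal{M}\subseteq\mathcal{N}$ (submodel) and $\{x\in N: x\in^{\mathcal{N}}a\}=\{x\in M:x\in^{\mathcal{M}}a\}$ for all $a\in M$; proper means $M\neq N$. $\mathcal{N}$ is a conservative extension of $\mathcal{M}$ if for every parametrically $\mathcal{N}$-definable $D$, $D\cap M$ is parametrically $\mathcal{M}$-definable. -}

module Defs where

open import Data.Nat using (ℕ; suc)
open import Data.Fin using (Fin)
open import Data.Product using (Σ; _×_; _,_)
open import Data.Sum using (_⊎_)
open import Data.Empty using (⊥)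
open import Data.Unit using (⊤)
open import Data.Vec.Functional using (Vector; _∷_)
open import Relation.Nullary using (¬_; Dec)
open import Relation.Binary.PropositionalEquality using (_≡_)
open import Function.Bundles using (_⇔_)

-- First-order language of set theory {∈} with equality.
-- Formulas with n free variables (de Bruijn indices: variable 0 is the
-- innermost bound / first entry of the environment).

data Formula : ℕ → Set where
  _∈'_ : ∀ {n} → Fin n → Fin n → Formula n
  _≐_  : ∀ {n} → Fin n → Fin n → Formula n
  ⊥'   : ∀ {n} → Formula n
  ¬'_  : ∀ {n} → Formula n → Formula n
  _∧'_ : ∀ {n} → Formula n → Formula n → Formula n
  _∨'_ : ∀ {n} → Formula n → Formula n → Formula n
  _⇒'_ : ∀ {n} → Formula n → Formula n → Formula n
  ∀'_  : ∀ {n} → Formula (suc n) → Formula n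
  ∃'_  : ∀ {n} → Formula (suc n) → Formula n

record Structure : Set₁ where
  field
    Dom : Set
    mem : Dom → Dom → Set

open Structure public

Sat : (𝓜 : Structure) {n : ℕ} → Formula n → Vector (Dom 𝓜) n → Set
Sat 𝓜 (i ∈' j) ρ = mem 𝓜 (ρ i) (ρ j)
Sat 𝓜 (i ≐ j)  ρ = ρ i ≡ ρ j
Sat 𝓜 ⊥'       ρ = ⊥
Sat 𝓜 (¬' φ)   ρ = ¬ Sat 𝓜 φ ρ
Sat 𝓜 (φ ∧' ψ) ρ = Sat 𝓜 φ ρ × Sat 𝓜 ψ ρ
Sat 𝓜 (φ ∨' ψ) ρ = Sat 𝓜 φ ρ ⊎ Sat 𝓜 ψ ρ
Sat 𝓜 (φ ⇒' ψ) ρ = Sat 𝓜 φ ρ → Sat 𝓜 ψ ρ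
Sat 𝓜 (∀' φ)   ρ = (x : Dom 𝓜) → Sat 𝓜 φ (x ∷ ρ)
Sat 𝓜 (∃' φ)   ρ = Σ (Dom 𝓜) λ x → Sat 𝓜 φ (x ∷ ρ)

-- 𝓜 ⊨ ZF  (axioms written out semantically, i.e. what satisfaction of
-- each axiom unfolds to; the schemas quantify over all formulas with
-- parameters).

module _ (𝓜 : Structure) where
  private
    D = Dom 𝓜
    _∈_ = mem 𝓜

  Extensionality : Set
  Extensionality = (a b : D) → ((x : D) → (x ∈ a) ⇔ (x ∈ b)) → a ≡ b

  Foundation : Set
  Foundation = (a : D) → Σ D (λ x → x ∈ a) →
    Σ D λ y → y ∈ a × ¬ Σ D (λ z → z ∈ y × z ∈ a)

  Pairing : Set
  Pairing = (a b : D) → Σ D λ c → a ∈ c × b ∈ c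

  Union : Set
  Union = (a : D) → Σ D λ u → (x y : D) → x ∈ y → y ∈ a → x ∈ u

  PowerSet : Set
  PowerSet = (a : D) → Σ D λ p → (x : D) → ((z : D) → z ∈ x → z ∈ a) → x ∈ p

  Infinity : Set
  Infinity = Σ D λ I →
      Σ D (λ e → e ∈ I × ((z : D) → ¬ (z ∈ e)))
    × ((x : D) → x ∈ I →
         Σ D λ y → y ∈ I × ((z : D) → (z ∈ y) ⇔ (z ∈ x ⊎ z ≡ x)))

  Separation : Set
  Separation = (n : ℕ) (φ : Formula (suc n)) (p : Vector D n) (a : D) →
    Σ D λ b → (x : D) → (x ∈ b) ⇔ (x ∈ a × Sat 𝓜 φ (x ∷ p))

  Replacement : Set
  Replacement = (n : ℕ) (φ : Formula (suc (suc n))) (p : Vector D n) (a : D) →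
    ((x : D) → x ∈ a →
       Σ D λ y → Sat 𝓜 φ (y ∷ x ∷ p) × ((y' : D) → Sat 𝓜 φ (y' ∷ x ∷ p) → y' ≡ y)) →
    Σ D λ b → (y : D) → (y ∈ b) ⇔ Σ D (λ x → x ∈ a × Sat 𝓜 φ (y ∷ x ∷ p))

  record IsZF : Set where
    field
      extensionality : Extensionality
      foundation     : Foundation
      pairing        : Pairing
      union          : Union
      powerSet       : PowerSet
      infinity       : Infinity
      separation     : Separation
      replacement    : Replacement

-- Extensions.  𝓜 ⊆ 𝓝 is represented by an embedding ι : Dom 𝓜 → Dom 𝓝
-- (identifying 𝓜 with its image).

module _ (𝓜 𝓝 : Structure) (ι : Dom 𝓜 → Dom 𝓝) where

  IsSubmodel : Set
  IsSubmodel = ((a b : Dom 𝓜) → ι a ≡ ι b → a ≡ b)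
             × ((a b : Dom 𝓜) → mem 𝓜 a b ⇔ mem 𝓝 (ι a) (ι b))

  IsEndExtension : Set
  IsEndExtension = IsSubmodel
    × ((a : Dom 𝓜) (y : Dom 𝓝) → mem 𝓝 y (ι a) → Σ (Dom 𝓜) λ x → ι x ≡ y)

  IsProper : Set
  IsProper = Σ (Dom 𝓝) λ y → ¬ Σ (Dom 𝓜) λ x → ι x ≡ y

  IsConservative : Set
  IsConservative =
    (n : ℕ) (φ : Formula (suc n)) (q : Vector (Dom 𝓝) n) →
    Σ ℕ λ m → Σ (Formula (suc m)) λ ψ → Σ (Vector (Dom 𝓜) m) λ p →
      (x : Dom 𝓜) → Sat 𝓝 φ (ι x ∷ q) ⇔ Sat 𝓜 ψ (x ∷ p)

-- Classical metatheory (the paper works classically).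
ExcludedMiddle : Set₁
ExcludedMiddle = (P : Set) → Dec P

{-# OPTIONS --safe #-}

-- Levels (the V_α, described without ordinals) are absolute between M and N, and by
-- conservativity every N-subset of an element of M is in M; hence a level g of N outside M
-- contains all of M.  Satisfaction in (g , ∈) is definable in N.  If M is closed under
-- witnesses for it ("g is good"), then M is an elementary substructure of g, the trace of this
-- satisfaction relation on M is a truth predicate for M, definable in M by conservativity, and
-- diagonalisation refutes it.  If g is not good, some existential statement with parameters in M
-- has its least witness level outside M, and this is a smaller level outside M.  Suppose no
-- level is good.  Levels outside M reached from a fixed g₀ by such descents are named by finite
-- sequences of elements of M; by conservativity the class of names is M-definable, so reflection
-- in M yields a set of names closed under one-step descent.  The levels named by it form a set
-- of N without ∈-minimal element, contradicting foundation in N.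

module Submission where

open import Defs
open import Data.Empty using (⊥; ⊥-elim)
open import Data.Fin using (Fin; zero; suc; lift; toℕ; _↑ˡ_; _↑ʳ_)
open import Data.Fin.Properties using (0≢1+n; toℕ-injective; toℕ<n) renaming (suc-injective to Fin-suc-injective)
open import Data.Nat using (ℕ; zero; suc; _+_; _<_; s≤s; z≤n)
open import Data.Nat.Properties using (<⇒≢; m<n⇒m<1+n; n<1+n; suc-injective)
open import Data.Product using (Σ; _×_; _,_; proj₁; proj₂)
open import Data.Sum using (_⊎_; inj₁; inj₂; [_,_]) renaming (map to map-⊎)
open import Data.Vec.Functional using (Vector; _∷_; head; tail)
open import Function.Base using (it)
open import Function.Bundles using (_⇔_; mk⇔; Equivalence)
open import Relation.Binary.PropositionalEquality using (_≡_; refl; sym; trans; cong; cong₂; subst; subst₂)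
open import Relation.Nullary using (¬_; yes; no)

-- Equivalences and their congruence rules

infix 1 _↔_
_↔_ : Set → Set → Set
A ↔ B = (A → B) × (B → A)

private
  variable
    A B A′ B′ : Set

↔-refl : A ↔ A
↔-refl = (λ x → x) , (λ x → x)

↔-sym : A ↔ B → B ↔ A
↔-sym (f , g) = g , f

↔-trans : A ↔ B → B ↔ A′ → A ↔ A′
↔-trans (f , g) (f′ , g′) = (λ x → f′ (f x)) , (λ x → g (g′ x))

×-cong : A ↔ A′ → B ↔ B′ → (A × B) ↔ (A′ × B′)
×-cong (f , g) (f′ , g′) = (λ (x , y) → f x , f′ y) , (λ (x , y) → g x , g′ y)

⊎-cong : A ↔ A′ → B ↔ B′ → (A ⊎ B) ↔ (A′ ⊎ B′)
⊎-cong (f , g) (f′ , g′) = map-⊎ f f′ , map-⊎ g g′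

→-cong : A ↔ A′ → B ↔ B′ → (A → B) ↔ (A′ → B′)
→-cong (f , g) (f′ , g′) = (λ h x → f′ (h (g x))) , (λ h x → g′ (h (f x)))

∀-cong : {P Q : A → Set} → (∀ x → P x ↔ Q x) → (∀ x → P x) ↔ (∀ x → Q x)
∀-cong e = (λ h x → proj₁ (e x) (h x)) , (λ h x → proj₂ (e x) (h x))

∃-cong : {P Q : A → Set} → (∀ x → P x ↔ Q x) → Σ A P ↔ Σ A Q
∃-cong e = (λ (x , p) → x , proj₁ (e x) p) , (λ (x , p) → x , proj₂ (e x) p)

-- Renaming of variables and definability with parameters

rename : ∀ {m n} → (Fin m → Fin n) → Formula m → Formula n
rename f (i ∈' j) = f i ∈' f j
rename f (i ≐ j)  = f i ≐ f j
rename f ⊥'       = ⊥'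
rename f (¬' φ)   = ¬' rename f φ
rename f (φ ∧' ψ) = rename f φ ∧' rename f ψ
rename f (φ ∨' ψ) = rename f φ ∨' rename f ψ
rename f (φ ⇒' ψ) = rename f φ ⇒' rename f ψ
rename f (∀' φ)   = ∀' rename (lift 1 f) φ
rename f (∃' φ)   = ∃' rename (lift 1 f) φ

module Definability (𝓢 : Structure) where
  private
    D = Dom 𝓢

  Sat-rename : ∀ {m n} (f : Fin m → Fin n) (φ : Formula m) {σ : Vector D m} {ρ : Vector D n} →
               (∀ i → ρ (f i) ≡ σ i) → Sat 𝓢 (rename f φ) ρ ↔ Sat 𝓢 φ σ
  Sat-rename f (i ∈' j) e rewrite e i | e j = ↔-refl
  Sat-rename f (i ≐ j) e rewrite e i | e j = ↔-refl
  Sat-rename f ⊥' e = ↔-refl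
  Sat-rename f (¬' φ) e = →-cong (Sat-rename f φ e) ↔-refl
  Sat-rename f (φ ∧' ψ) e = ×-cong (Sat-rename f φ e) (Sat-rename f ψ e)
  Sat-rename f (φ ∨' ψ) e = ⊎-cong (Sat-rename f φ e) (Sat-rename f ψ e)
  Sat-rename f (φ ⇒' ψ) e = →-cong (Sat-rename f φ e) (Sat-rename f ψ e)
  Sat-rename f (∀' φ) e = ∀-cong λ x → Sat-rename (lift 1 f) φ λ { zero → refl ; (suc i) → e i }
  Sat-rename f (∃' φ) e = ∃-cong λ x → Sat-rename (lift 1 f) φ λ { zero → refl ; (suc i) → e i }

  infixr 5 _⊕_
  _⊕_ : ∀ {n m} → Vector D n → Vector D m → Vector D (n + m)
  _⊕_ {zero}  ρ q = q
  _⊕_ {suc n} ρ q = head ρ ∷ (tail ρ ⊕ q)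

  ⊕-↑ˡ : ∀ {n m} (ρ : Vector D n) (q : Vector D m) i → (ρ ⊕ q) (i ↑ˡ m) ≡ ρ i
  ⊕-↑ˡ ρ q zero    = refl
  ⊕-↑ˡ ρ q (suc i) = ⊕-↑ˡ (tail ρ) q i

  ⊕-↑ʳ : ∀ {n m} (ρ : Vector D n) (q : Vector D m) i → (ρ ⊕ q) (n ↑ʳ i) ≡ q i
  ⊕-↑ʳ {zero}  ρ q i = refl
  ⊕-↑ʳ {suc n} ρ q i = ⊕-↑ʳ (tail ρ) q i

  embed : ∀ {n k m m′} → (Fin n → Fin k) → (Fin m → Fin m′) → Fin (n + m) → Fin (k + m′)
  embed {zero}  {k} f g i       = k ↑ʳ g i
  embed {suc n} f g zero    = f zero ↑ˡ _
  embed {suc n} f g (suc i) = embed (λ j → f (suc j)) g i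

  ⊕-embed : ∀ {n k m m′} (f : Fin n → Fin k) (g : Fin m → Fin m′)
            (ρ : Vector D k) {q : Vector D m} {q′ : Vector D m′} → (∀ i → q′ (g i) ≡ q i) →
            ∀ i → (ρ ⊕ q′) (embed f g i) ≡ ((λ j → ρ (f j)) ⊕ q) i
  ⊕-embed {zero} f g ρ {q′ = q′} e i = trans (⊕-↑ʳ ρ q′ (g i)) (e i)
  ⊕-embed {suc n} f g ρ {q′ = q′} e zero = ⊕-↑ˡ ρ q′ (f zero)
  ⊕-embed {suc n} f g ρ e (suc i) = ⊕-embed (λ j → f (suc j)) g ρ e i

  -- Definability with parameters.  Predicates are written as Agda types over an environment ρ, and
  -- instance search reads a defining formula off their shape.
  record Def {n} (P : Vector D n → Set) : Set where
    no-eta-equality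
    pattern
    constructor mkDef
    field
      {arity}  : ℕ
      formula  : Formula (n + arity)
      params   : Vector D arity
      defines  : ∀ ρ → P ρ ↔ Sat 𝓢 formula (ρ ⊕ params)

  private
    variable
      n : ℕ
      P Q : Vector D n → Set

  def-↔ : (∀ ρ → P ρ ↔ Q ρ) → Def P → Def Q
  def-↔ e (mkDef φ q d) = mkDef φ q λ ρ → ↔-trans (↔-sym (e ρ)) (d ρ)

  def-rename : ∀ {k} (f : Fin n → Fin k) → Def P → Def (λ ρ → P (λ i → ρ (f i)))
  def-rename f (mkDef φ q d) = mkDef (rename (embed f (λ i → i)) φ) q λ ρ →
    ↔-trans (d _) (↔-sym (Sat-rename _ φ (⊕-embed f (λ i → i) ρ (λ i → refl))))

  -- The two parameter lists are concatenated, so that both formulas live over one environment and a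
  -- connective can join them.
  record Merged {n} (P Q : Vector D n → Set) : Set where
    no-eta-equality
    pattern
    constructor mkMerged
    field
      {arity}   : ℕ
      φ ψ       : Formula (n + arity)
      params    : Vector D arity
      defines-φ : ∀ ρ → P ρ ↔ Sat 𝓢 φ (ρ ⊕ params)
      defines-ψ : ∀ ρ → Q ρ ↔ Sat 𝓢 ψ (ρ ⊕ params)

  merge : Def P → Def Q → Merged P Q
  merge {n} (mkDef {m} φ q d) (mkDef {m′} ψ q′ d′) =
    mkMerged (rename (embed {n} (λ i → i) (_↑ˡ m′)) φ) (rename (embed {n} (λ i → i) (m ↑ʳ_)) ψ) (q ⊕ q′)
      (λ ρ → ↔-trans (d ρ) (↔-sym (Sat-rename _ φ (⊕-embed (λ i → i) _ ρ (⊕-↑ˡ q q′)))))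
      (λ ρ → ↔-trans (d′ ρ) (↔-sym (Sat-rename _ ψ (⊕-embed (λ i → i) _ ρ (⊕-↑ʳ q q′)))))

  -- The language has no function symbols, so a term counts as definable when its graph is.
  record DefT {n} (t : Vector D n → D) : Set where
    no-eta-equality
    pattern
    constructor mkDefT
    field graph : Def {suc n} (λ ρ → head ρ ≡ t (tail ρ))

  private
    none : Vector D 0
    none ()

  instance
    def-var : {i : Fin n} → DefT (λ ρ → ρ i)
    def-var {i = i} = mkDefT (mkDef (zero ≐ suc (i ↑ˡ 0)) none λ ρ →
      let e = ⊕-↑ˡ (tail ρ) none i in (λ x → trans x (sym e)) , (λ x → trans x e))

    def-const : {d : D} → DefT {n} (λ _ → d)
    def-const {n} {d} = mkDefT (mkDef (zero ≐ suc (n ↑ʳ zero)) (d ∷ none) λ ρ →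
      let e = ⊕-↑ʳ (tail ρ) (d ∷ none) zero in (λ x → trans x (sym e)) , (λ x → trans x e))

    def-⊥ : Def {n} (λ _ → ⊥)
    def-⊥ = mkDef ⊥' none λ ρ → ↔-refl

    def-× : {{Def P}} → {{Def Q}} → Def (λ ρ → P ρ × Q ρ)
    def-× {{p}} {{q}} with mkMerged φ ψ v d d′ ← merge p q = mkDef (φ ∧' ψ) v λ ρ → ×-cong (d ρ) (d′ ρ)

    def-⊎ : {{Def P}} → {{Def Q}} → Def (λ ρ → P ρ ⊎ Q ρ)
    def-⊎ {{p}} {{q}} with mkMerged φ ψ v d d′ ← merge p q = mkDef (φ ∨' ψ) v λ ρ → ⊎-cong (d ρ) (d′ ρ)

    def-→ : {{Def P}} → {{Def Q}} → Def (λ ρ → P ρ → Q ρ)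
    def-→ {{p}} {{q}} with mkMerged φ ψ v d d′ ← merge p q = mkDef (φ ⇒' ψ) v λ ρ → →-cong (d ρ) (d′ ρ)

    def-∀ : {P : D → Vector D n → Set} → {{Def (λ ρ → P (head ρ) (tail ρ))}} → Def (λ ρ → (x : D) → P x ρ)
    def-∀ {{mkDef φ q d}} = mkDef (∀' φ) q λ ρ → ∀-cong λ x → d (x ∷ ρ)

    def-∃ : {P : D → Vector D n → Set} → {{Def (λ ρ → P (head ρ) (tail ρ))}} → Def (λ ρ → Σ D λ x → P x ρ)
    def-∃ {{mkDef φ q d}} = mkDef (∃' φ) q λ ρ → ∃-cong λ x → d (x ∷ ρ)

  defT-tail : {t : Vector D n → D} → DefT t → DefT (λ ρ → t (tail ρ))
  defT-tail (mkDefT d) = mkDefT (def-rename (lift 1 suc) d)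

  -- Substitution of a term without function symbols: `R (t ρ) ρ` is expressed as "some `x` equals
  -- `t ρ` and satisfies `R x ρ`".
  def-at : {R : D → Vector D n → Set} {t : Vector D n → D} →
           DefT t → Def (λ ρ → R (head ρ) (tail ρ)) → Def (λ ρ → R (t ρ) ρ)
  def-at {R = R} {t} (mkDefT dt) r =
    def-↔ (λ ρ → (λ (x , p , z) → subst (λ v → R v ρ) p z) , (λ z → t ρ , refl , z))
      (def-∃ {P = λ x ρ → x ≡ t ρ × R x ρ} {{def-× {{dt}} {{r}} }})

  -- Lifts a definition on bare variables to arbitrary definable terms; together with its versions
  -- of higher arity it feeds instance search with each newly defined relation.
  def-subst₁ : (R : D → Set) → Def {1} (λ ρ → R (ρ zero)) →
               {s : Vector D n → D} → {{DefT s}} → Def (λ ρ → R (s ρ))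
  def-subst₁ {n} R r {{s}} = def-at {R = λ x ρ → R x} s (def-rename (_↑ˡ n) r)

  def-subst₂ : (R : D → D → Set) → Def {2} (λ ρ → R (ρ zero) (ρ (suc zero))) →
               {s t : Vector D n → D} → {{DefT s}} → {{DefT t}} → Def (λ ρ → R (s ρ) (t ρ))
  def-subst₂ {n} R r {s} {{ds}} {{dt}} =
    def-at {R = λ y ρ → R (s ρ) y} dt
      (def-at {R = λ x ρ → R x (head ρ)} (defT-tail ds) (def-rename (_↑ˡ n) r))

  def-subst₃ : (R : D → D → D → Set) → Def {3} (λ ρ → R (ρ zero) (ρ (suc zero)) (ρ (suc (suc zero)))) →
               {s t u : Vector D n → D} → {{DefT s}} → {{DefT t}} → {{DefT u}} →
               Def (λ ρ → R (s ρ) (t ρ) (u ρ))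
  def-subst₃ {n} R r {s} {t} {{ds}} {{dt}} {{du}} =
    def-at {R = λ z ρ → R (s ρ) (t ρ) z} du
      (def-at {R = λ y ρ → R (s (tail ρ)) y (head ρ)} (defT-tail dt)
        (def-at {R = λ x ρ → R x (head ρ) (head (tail ρ))} (defT-tail (defT-tail ds)) (def-rename (_↑ˡ n) r)))

  def-subst₄ : (R : D → D → D → D → Set) →
               Def {4} (λ ρ → R (ρ zero) (ρ (suc zero)) (ρ (suc (suc zero))) (ρ (suc (suc (suc zero))))) →
               {s t u v : Vector D n → D} → {{DefT s}} → {{DefT t}} → {{DefT u}} → {{DefT v}} →
               Def (λ ρ → R (s ρ) (t ρ) (u ρ) (v ρ))
  def-subst₄ {n} R r {s} {t} {u} {{ds}} {{dt}} {{du}} {{dv}} =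
    def-at {R = λ z ρ → R (s ρ) (t ρ) (u ρ) z} dv
      (def-at {R = λ z ρ → R (s (tail ρ)) (t (tail ρ)) z (head ρ)} (defT-tail du)
        (def-at {R = λ y ρ → R (s (tail (tail ρ))) y (head ρ) (head (tail ρ))} (defT-tail (defT-tail dt))
          (def-at {R = λ x ρ → R x (head ρ) (head (tail ρ)) (head (tail (tail ρ)))}
            (defT-tail (defT-tail (defT-tail ds))) (def-rename (_↑ˡ n) r))))

  instance
    def-mem : {s t : Vector D n → D} → {{DefT s}} → {{DefT t}} → Def (λ ρ → mem 𝓢 (s ρ) (t ρ))
    def-mem = def-subst₂ (mem 𝓢) (mkDef (zero ∈' suc zero) none λ ρ → ↔-refl)

    def-≡ : {s t : Vector D n → D} → {{DefT s}} → {{DefT t}} → Def (λ ρ → s ρ ≡ t ρ)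
    def-≡ = def-subst₂ _≡_ (mkDef (zero ≐ suc zero) none λ ρ → ↔-refl)

subst-↔ : {A : Set} (P : A → Set) {x y : A} → x ≡ y → P x ↔ P y
subst-↔ P refl = ↔-refl

⇔⇒↔ : {A B : Set} → A ⇔ B → A ↔ B
⇔⇒↔ e = Equivalence.to e , Equivalence.from e

↔⇒⇔ : {A B : Set} → A ↔ B → A ⇔ B
↔⇒⇔ (f , g) = mk⇔ f g

-- Elementary set theory inside a model of ZF

module SetTheory (em : ExcludedMiddle) (𝓢 : Structure) (zf : IsZF 𝓢) where
  open Definability 𝓢 public
  open IsZF zf

  D : Set
  D = Dom 𝓢

  infix 4 _∈_ _⊆_
  _∈_ : D → D → Set
  _∈_ = mem 𝓢

  _⊆_ : D → D → Set
  a ⊆ b = ∀ z → z ∈ a → z ∈ b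

  by-contradiction : {A : Set} → ¬ ¬ A → A
  by-contradiction {A} h with em A
  ... | yes a = a
  ... | no ¬a = ⊥-elim (h ¬a)

  ext : ∀ {a b} → (∀ x → x ∈ a ↔ x ∈ b) → a ≡ b
  ext {a} {b} e = extensionality a b λ x → ↔⇒⇔ (e x)

  ⊆-antisym : ∀ {a b} → a ⊆ b → b ⊆ a → a ≡ b
  ⊆-antisym p q = ext λ x → p x , q x

  Def₁ : (D → Set) → Set
  Def₁ P = Def {1} (λ ρ → P (ρ zero))

  Def₂ : (D → D → Set) → Set
  Def₂ R = Def {2} (λ ρ → R (ρ zero) (ρ (suc zero)))

  opaque
    sep : (a : D) (P : D → Set) → {{Def₁ P}} → Σ D λ b → ∀ x → x ∈ b ↔ (x ∈ a × P x)
    sep a P {{mkDef {m} φ q d}} with separation m φ q a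
    ... | b , e = b , λ x → ↔-trans (⇔⇒↔ (e x)) (×-cong ↔-refl (↔-sym (d (λ _ → x))))

    repl : (a : D) (F : D → D → Set) → {{Def₂ F}} →
           (∀ x → x ∈ a → Σ D λ y → F x y × (∀ y′ → F x y′ → y′ ≡ y)) →
           Σ D λ b → ∀ y → y ∈ b ↔ Σ D λ x → x ∈ a × F x y
    -- The replacement schema puts the value before the argument in the environment, whereas `F`
    -- takes the argument first.
    repl a F {{d}} h with def-rename {P = λ ρ → F (ρ zero) (ρ (suc zero))} swap d
      where
      swap : Fin 2 → Fin 2
      swap zero       = suc zero
      swap (suc zero) = zero
    ... | mkDef {m} φ q e with replacement m φ q a (λ x x∈a → let (y , p , u) = h x x∈a in
            y , proj₁ (e (y ∷ x ∷ λ ())) p , λ y′ p′ → u y′ (proj₂ (e (y′ ∷ x ∷ λ ())) p′))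
    ... | b , s = b , λ y → ↔-trans (⇔⇒↔ (s y))
            (∃-cong λ x → ×-cong ↔-refl (↔-sym (e (y ∷ x ∷ λ ()))))

  Empty : D → Set
  Empty e = ∀ z → ¬ z ∈ e

  opaque
    ∅ : D
    ∅ = proj₁ (proj₁ (proj₂ infinity))

    ∉∅ : Empty ∅
    ∉∅ = proj₂ (proj₂ (proj₁ (proj₂ infinity)))

    private
      upair-set : ∀ a b → Σ D λ c → ∀ x → x ∈ c ↔ (x ∈ proj₁ (pairing a b) × (x ≡ a ⊎ x ≡ b))
      upair-set a b = sep (proj₁ (pairing a b)) (λ x → x ≡ a ⊎ x ≡ b)

      ⋃-set : ∀ a → Σ D λ c → ∀ x → x ∈ c ↔ (x ∈ proj₁ (union a) × (Σ D λ y → x ∈ y × y ∈ a))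
      ⋃-set a = sep (proj₁ (union a)) (λ x → Σ D λ y → x ∈ y × y ∈ a)

    upair : D → D → D
    upair a b = proj₁ (upair-set a b)

    ∈-upair : ∀ {a b} x → x ∈ upair a b ↔ (x ≡ a ⊎ x ≡ b)
    ∈-upair {a} {b} x = (λ m → proj₂ (proj₁ (proj₂ (upair-set a b) x) m)) ,
                        λ m → proj₂ (proj₂ (upair-set a b) x) (in-pairing m , m)
      where
      in-pairing : x ≡ a ⊎ x ≡ b → x ∈ proj₁ (pairing a b)
      in-pairing (inj₁ refl) = proj₁ (proj₂ (pairing a b))
      in-pairing (inj₂ refl) = proj₂ (proj₂ (pairing a b))

    ⋃ : D → D
    ⋃ a = proj₁ (⋃-set a)

    ∈-⋃ : ∀ {a} x → x ∈ ⋃ a ↔ Σ D λ y → x ∈ y × y ∈ a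
    ∈-⋃ {a} x = (λ m → proj₂ (proj₁ (proj₂ (⋃-set a) x) m)) ,
                λ m@(y , p , q) → proj₂ (proj₂ (⋃-set a) x) (proj₂ (union a) x y p q , m)

  ∅-unique : ∀ {e} → Empty e → e ≡ ∅
  ∅-unique h = ext λ x → (λ m → ⊥-elim (h x m)) , (λ m → ⊥-elim (∉∅ x m))

  left∈upair : ∀ {a b} → a ∈ upair a b
  left∈upair = proj₂ (∈-upair _) (inj₁ refl)

  right∈upair : ∀ {a b} → b ∈ upair a b
  right∈upair = proj₂ (∈-upair _) (inj₂ refl)

  ∈-singleton : ∀ {a x} → x ∈ upair a a → x ≡ a
  ∈-singleton m = [ (λ e → e) , (λ e → e) ] (proj₁ (∈-upair _) m)

  ≡-upair : ∀ {a b z} → z ≡ upair a b ↔ (∀ w → w ∈ z ↔ (w ≡ a ⊎ w ≡ b))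
  ≡-upair = (λ { refl w → ∈-upair w }) , λ h → ext λ w → ↔-trans (h w) (↔-sym (∈-upair w))

  ≡-singleton : ∀ {a z} → z ≡ upair a a ↔ (∀ w → w ∈ z ↔ w ≡ a)
  ≡-singleton = (λ { refl w → ∈-singleton , λ { refl → left∈upair } }) ,
                λ h → ext λ w → ↔-trans (h w) ((λ { refl → left∈upair }) , ∈-singleton)

  infixl 6 _∪_
  _∪_ : D → D → D
  a ∪ b = ⋃ (upair a b)

  ∪-left : ∀ {a b} → a ⊆ a ∪ b
  ∪-left x m = proj₂ (∈-⋃ x) (_ , m , left∈upair)

  ∪-right : ∀ {a b} → b ⊆ a ∪ b
  ∪-right x m = proj₂ (∈-⋃ x) (_ , m , right∈upair)

  ∈-∪ : ∀ {a b} x → x ∈ a ∪ b → x ∈ a ⊎ x ∈ b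
  ∈-∪ x m with proj₁ (∈-⋃ x) m
  ... | y , x∈y , y∈ with proj₁ (∈-upair y) y∈
  ... | inj₁ refl = inj₁ x∈y
  ... | inj₂ refl = inj₂ x∈y

  ∈-asym : ∀ {x y} → x ∈ y → ¬ y ∈ x
  ∈-asym {x} {y} p q with foundation (upair x y) (x , left∈upair)
  ... | z , z∈ , min with proj₁ (∈-upair z) z∈
  ... | inj₁ refl = min (y , q , right∈upair)
  ... | inj₂ refl = min (x , p , left∈upair)

  ∈-irrefl : ∀ {x} → ¬ x ∈ x
  ∈-irrefl p = ∈-asym p p

  opaque
    opair : D → D → D
    opair a b = upair (upair a a) (upair a b)

    ∈-opair : ∀ {a b} z → z ∈ opair a b ↔
              ((∀ w → w ∈ z ↔ w ≡ a) ⊎ (∀ w → w ∈ z ↔ (w ≡ a ⊎ w ≡ b)))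
    ∈-opair z = ↔-trans (∈-upair z) (⊎-cong ≡-singleton ≡-upair)

    singleton∈opair : ∀ {a b} → upair a a ∈ opair a b
    singleton∈opair = left∈upair

    opair-as-upair : ∀ {a b} → opair a b ≡ upair (upair a a) (upair a b)
    opair-as-upair = refl

    opair-injˡ : ∀ {a b c d} → opair a b ≡ opair c d → a ≡ c
    opair-injˡ {a} {b} {c} {d} e with proj₁ (∈-upair (upair a a)) (subst (upair a a ∈_) e left∈upair)
    ... | inj₁ e′ = sym (∈-singleton (subst (c ∈_) (sym e′) left∈upair))
    ... | inj₂ e′ = sym (∈-singleton (subst (c ∈_) (sym e′) left∈upair))

    private
      second : ∀ {a b d} → upair a d ∈ opair a b → d ≡ a ⊎ d ≡ b
      second {a} {b} {d} m with proj₁ (∈-upair (upair a d)) m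
      ... | inj₁ e = inj₁ (∈-singleton (subst (d ∈_) e right∈upair))
      ... | inj₂ e = proj₁ (∈-upair d) (subst (d ∈_) e right∈upair)

    opair-injʳ : ∀ {a b c d} → opair a b ≡ opair c d → b ≡ d
    opair-injʳ {a} {b} {c} {d} e with opair-injˡ e
    ... | refl with second (subst (upair a b ∈_) e right∈upair) | second (subst (upair a d ∈_) (sym e) right∈upair)
    ... | inj₂ p | _      = p
    ... | inj₁ p | inj₁ q = trans p (sym q)
    ... | inj₁ p | inj₂ q = sym q

  opair-inj : ∀ {a b c d} → opair a b ≡ opair c d → a ≡ c × b ≡ d
  opair-inj e = opair-injˡ e , opair-injʳ e

  private
    variable
      n : ℕ

  opaque
    def-opair₃ : Def {3} (λ ρ → ρ zero ≡ opair (ρ (suc zero)) (ρ (suc (suc zero))))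
    def-opair₃ = def-↔
      {P = λ ρ → ∀ z → z ∈ ρ zero ↔ ((∀ w → w ∈ z ↔ w ≡ ρ (suc zero)) ⊎
                 (∀ w → w ∈ z ↔ (w ≡ ρ (suc zero) ⊎ w ≡ ρ (suc (suc zero)))))}
      (λ ρ → (λ h → ext λ z → ↔-trans (h z) (↔-sym (∈-opair z))) ,
             (λ e z → ↔-trans (subst-↔ (z ∈_) e) (∈-opair z)))
      it

  instance
    def-opair : {s t : Vector D n → D} → {{DefT s}} → {{DefT t}} → DefT (λ ρ → opair (s ρ) (t ρ))
    def-opair {{ds}} {{dt}} =
      mkDefT (def-subst₃ (λ z x y → z ≡ opair x y) def-opair₃ {{def-var}} {{defT-tail ds}} {{defT-tail dt}})

  -- J g f p reads "p is justified by members of f"; g is a parameter.  Membership in a set all of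
  -- whose members are justified by it replaces recursion.
  module Derivation (J : D → D → D → Set)
                    (J-mono : ∀ {g f f′ p} → f ⊆ f′ → J g f p → J g f′ p) where

    Closed : D → D → Set
    Closed g f = ∀ q → q ∈ f → J g f q

    record Derivable (g p : D) : Set where
      constructor derivable
      field
        tree   : D
        root∈  : p ∈ tree
        closed : Closed g tree

    closed-∪ : ∀ {g f f′} → Closed g f → Closed g f′ → Closed g (f ∪ f′)
    closed-∪ c c′ q m with ∈-∪ q m
    ... | inj₁ q∈ = J-mono ∪-left (c q q∈)
    ... | inj₂ q∈ = J-mono ∪-right (c′ q q∈)

    derive : ∀ {g p} f → Closed g f → J g f p → Derivable g p
    derive {g} {p} f c j = derivable (f ∪ upair p p) (∪-right p left∈upair) λ q m → J-mono ∪-left (just q (∈-∪ q m))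
      where
      just : ∀ q → q ∈ f ⊎ q ∈ upair p p → J g f q
      just q (inj₁ q∈) = c q q∈
      just q (inj₂ q∈) = subst (J g f) (sym (∈-singleton q∈)) j

    invert : ∀ {g p} → Derivable g p → Σ D λ f → J g f p × (∀ q → q ∈ f → Derivable g q)
    invert (derivable f m c) = f , c _ m , λ q q∈ → derivable f q∈ c

    ∅-closed : ∀ {g} → Closed g ∅
    ∅-closed q m = ⊥-elim (∉∅ q m)

    def-Derivable : Def {3} (λ ρ → J (ρ zero) (ρ (suc zero)) (ρ (suc (suc zero)))) →
                    {s t : Vector D n → D} → {{DefT s}} → {{DefT t}} → Def (λ ρ → Derivable (s ρ) (t ρ))
    def-Derivable dJ = def-subst₂ Derivable (def-↔
      {P = λ ρ → Σ D λ f → ρ (suc zero) ∈ f × (∀ q → q ∈ f → J (ρ zero) f q)}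
      (λ ρ → (λ (f , m , c) → derivable f m c) , (λ (derivable f m c) → f , m , c))
      it)
      where instance
      def-J : ∀ {k} {s t u : Vector D k → D} → {{DefT s}} → {{DefT t}} → {{DefT u}} → Def (λ ρ → J (s ρ) (t ρ) (u ρ))
      def-J = def-subst₃ J dJ

  -- Natural numbers and iteration

  Succ : D → D → Set
  Succ x y = ∀ z → z ∈ y ↔ (z ∈ x ⊎ z ≡ x)

  succ-inj : ∀ {x x′ y} → Succ x y → Succ x′ y → x ≡ x′
  succ-inj {x} {x′} s s′ with proj₁ (s′ x) (proj₂ (s x) (inj₂ refl)) | proj₁ (s x′) (proj₂ (s′ x′) (inj₂ refl))
  ... | inj₂ e | _      = e
  ... | inj₁ _ | inj₂ e = sym e
  ... | inj₁ p | inj₁ q = ⊥-elim (∈-asym p q)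

  succ-unique : ∀ {x y y′} → Succ x y → Succ x y′ → y ≡ y′
  succ-unique s s′ = ext λ z → ↔-trans (s z) (↔-sym (s′ z))

  succ : D → D
  succ x = x ∪ upair x x

  succ-Succ : ∀ {x} → Succ x (succ x)
  succ-Succ {x} z = (λ m → map-⊎ (λ p → p) ∈-singleton (∈-∪ z m)) ,
                    [ ∪-left z , (λ { refl → ∪-right z left∈upair }) ]

  Inductive : D → Set
  Inductive J = (∀ e → Empty e → e ∈ J) × (∀ x → x ∈ J → ∀ y → Succ x y → y ∈ J)

  private
    I : D
    I = proj₁ infinity

    I-inductive : Inductive I
    I-inductive =
      (λ e h → let (e′ , e′∈I , h′) = proj₁ (proj₂ infinity) in
        subst (_∈ I) (trans (∅-unique h′) (sym (∅-unique h))) e′∈I) ,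
      (λ x x∈ y s → let (y′ , y′∈ , s′) = proj₂ (proj₂ infinity) x x∈ in
        subst (_∈ I) (succ-unique (λ z → ⇔⇒↔ (s′ z)) s) y′∈)

  opaque
    private
      ω-set : Σ D λ w → ∀ n → n ∈ w ↔ (n ∈ I × (∀ J → Inductive J → n ∈ J))
      ω-set = sep I (λ n → ∀ J → Inductive J → n ∈ J)

    ω : D
    ω = proj₁ ω-set

    private
      ∈-ω : ∀ n → n ∈ ω ↔ (n ∈ I × (∀ J → Inductive J → n ∈ J))
      ∈-ω = proj₂ ω-set

  ω-inductive : Inductive ω
  ω-inductive =
    (λ e h → proj₂ (∈-ω e) (proj₁ I-inductive e h , λ J i → proj₁ i e h)) ,
    (λ x m y s → let (x∈I , x∈) = proj₁ (∈-ω x) m in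
      proj₂ (∈-ω y) (proj₂ I-inductive x x∈I y s , λ J i → proj₂ i x (x∈ J i) y s))

  ω-induction : (P : D → Set) → {{Def₁ P}} → P ∅ → (∀ x → x ∈ ω → P x → P (succ x)) → ∀ x → x ∈ ω → P x
  ω-induction P base step x m = let (J , e) = sep ω P in
    proj₂ (proj₁ (e x) (proj₂ (proj₁ (∈-ω x) m) J
      ((λ z h → proj₂ (e z) (proj₁ ω-inductive z h , subst P (sym (∅-unique h)) base)) ,
       (λ z z∈ y s → let (z∈ω , Pz) = proj₁ (e z) z∈ in
         proj₂ (e y) (proj₂ ω-inductive z z∈ω y s , subst P (succ-unique succ-Succ s) (step z z∈ω Pz))))))

  -- The graph n ↦ Hⁿ(a) is given by derivations; its range is a set by replacement over ω.
  module Iteration (H : D → D → Set) (def-H₂ : Def₂ H)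
                   (H-functional : ∀ x → Σ D λ y → H x y × (∀ y′ → H x y′ → y′ ≡ y)) where
    private
      instance
        def-H : {s t : Vector D n → D} → {{DefT s}} → {{DefT t}} → Def (λ ρ → H (s ρ) (t ρ))
        def-H = def-subst₂ H def-H₂

      J : D → D → D → Set
      J a f p = p ≡ opair ∅ a ⊎
                Σ D λ k → Σ D λ l → Σ D λ u → Σ D λ w → p ≡ opair l w × Succ k l × H u w × opair k u ∈ f

      open Derivation J (λ s → map-⊎ (λ e → e) λ (k , l , u , w , e , s′ , h , m) → k , l , u , w , e , s′ , h , s _ m)

      instance
        def-Iter : {s t : Vector D n → D} → {{DefT s}} → {{DefT t}} → Def (λ ρ → Derivable (s ρ) (t ρ))
        def-Iter = def-Derivable it

      module _ (a : D) where
        Iter : D → D → Set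
        Iter k v = Derivable a (opair k v)

        iter-zero : Iter ∅ a
        iter-zero = derive ∅ ∅-closed (inj₁ refl)

        iter-succ : ∀ {k u w} → Iter k u → H u w → Iter (succ k) w
        iter-succ (derivable f m c) h = derive f c (inj₂ (_ , _ , _ , _ , refl , succ-Succ , h , m))

        -- Uniqueness comes from inverting a derivation: its last step can only pass from the
        -- predecessor, which is determined because successors are injective.
        iter-functional : ∀ x → x ∈ ω → Σ D λ v → Iter x v × (∀ v′ → Iter x v′ → v′ ≡ v)
        iter-functional = ω-induction (λ x → Σ D λ v → Iter x v × (∀ v′ → Iter x v′ → v′ ≡ v))
          (a , iter-zero , at-zero)
          λ k _ (u , i , unique) → let (w , h , _) = H-functional u in w , iter-succ i h , at-succ unique h
          where
          at-zero : ∀ v → Iter ∅ v → v ≡ a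
          at-zero v d with invert d
          ... | f , inj₁ e , _ = opair-injʳ e
          ... | f , inj₂ (k , l , u , w , e , s , _) , _ =
            ⊥-elim (∉∅ k (subst (k ∈_) (sym (opair-injˡ e)) (proj₂ (s k) (inj₂ refl))))
          at-succ : ∀ {k u w} → (∀ u′ → Iter k u′ → u′ ≡ u) → H u w → ∀ v → Iter (succ k) v → v ≡ w
          at-succ {k} unique h v d with invert d
          ... | f , inj₁ e , _ = ⊥-elim (∉∅ k (subst (k ∈_) (opair-injˡ e) (∪-right k left∈upair)))
          ... | f , inj₂ (k′ , l , u′ , w′ , e , s , h′ , m) , ds with opair-inj e
          ... | refl , refl with succ-inj s succ-Succ
          ... | refl with unique u′ (ds _ m)
          ... | refl = let (_ , _ , un) = H-functional u′ in trans (un _ h′) (sym (un _ h))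

    closure : (a : D) → Σ D λ b → a ∈ b × (∀ v w → v ∈ b → H v w → w ∈ b)
    closure a = let (b , e) = repl ω (Iter a) (iter-functional a) in
      b , proj₂ (e a) (∅ , proj₁ ω-inductive ∅ ∉∅ , iter-zero a) , λ v w v∈ h →
      let (k , k∈ω , i) = proj₁ (e v) v∈ in
      proj₂ (e w) (succ k , proj₂ ω-inductive k k∈ω (succ k) succ-Succ , iter-succ a i h)

-- Levels of the cumulative hierarchy

module Levels (em : ExcludedMiddle) (𝓢 : Structure) (zf : IsZF 𝓢) where
  open SetTheory em 𝓢 zf public
  open IsZF zf

  private
    variable
      n : ℕ

  Transitive : D → Set
  Transitive t = ∀ z w → w ∈ z → z ∈ t → w ∈ t

  -- Levels are the V_α, described without ordinals (Scott, Montague, Button): a history is an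
  -- initial segment of the sequence of the V_α, and V_α = { z | z ⊆ V_β for some β < α }.
  Hist : D → Set
  Hist h = ∀ x → x ∈ h → ∀ z → z ∈ x ↔ Σ D λ c → (c ∈ x × c ∈ h) × z ⊆ c

  record Lev (s : D) : Set where
    constructor mkLev
    field
      history : D
      isHist  : Hist history
      spec    : ∀ z → z ∈ s ↔ Σ D λ c → c ∈ history × z ⊆ c

  private
    def-Lev₁ : Def₁ Lev
    def-Lev₁ = def-↔
      {P = λ ρ → Σ D λ h → Hist h × (∀ z → z ∈ ρ zero ↔ Σ D λ c → c ∈ h × z ⊆ c)}
      (λ ρ → (λ (h , p , q) → mkLev h p q) , (λ (mkLev h p q) → h , p , q)) it

  instance
    def-Lev : {s : Vector D n → D} → {{DefT s}} → Def (λ ρ → Lev (s ρ))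
    def-Lev = def-subst₁ Lev def-Lev₁

  opaque
    minimal : (a : D) (P : D → Set) → {{Def₁ P}} → Σ D (λ x → x ∈ a × P x) →
              Σ D λ x → x ∈ a × P x × (∀ y → y ∈ x → y ∈ a → ¬ P y)
    minimal a P (x , x∈a , Px) =
      let (b , e) = sep a P
          (y , y∈b , min) = foundation b (x , proj₂ (e x) (x∈a , Px))
          (y∈a , Py) = proj₁ (e y) y∈b
      in y , y∈a , Py , λ z z∈y z∈a Pz → min (z , z∈y , proj₂ (e z) (z∈a , Pz))

  -- Take an ∈-minimal non-transitive `d` in `h`. A member `z` of `d` is included in some `e` of the
  -- history below `d`; `e` is transitive, so the members of `z` are subsets of `e` and hence belong
  -- to `d`.
  hist-transitive : ∀ {h} → Hist h → ∀ c → c ∈ h → Transitive c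
  hist-transitive {h} H c c∈h = by-contradiction λ ¬t →
    let (d , d∈h , ¬td , min) = minimal h (λ c → ¬ Transitive c) (c , c∈h , ¬t) in
    ¬td λ z w w∈z z∈d →
      let (e , (e∈d , e∈h) , z⊆e) = proj₁ (H d d∈h z) z∈d in
      proj₂ (H d d∈h w)
        (e , (e∈d , e∈h) , λ v v∈w → by-contradiction (min e e∈d e∈h) w v v∈w (z⊆e w w∈z))

  lev-transitive : ∀ {s} → Lev s → Transitive s
  lev-transitive (mkLev h H spec) z w w∈z z∈s =
    let (c , c∈h , z⊆c) = proj₁ (spec z) z∈s in
    proj₂ (spec w) (c , c∈h , λ v v∈w → hist-transitive H c c∈h w v v∈w (z⊆c w w∈z))

  lev-potent : ∀ {s z y} → Lev s → z ⊆ y → y ∈ s → z ∈ s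
  lev-potent (mkLev h H spec) z⊆y y∈s =
    let (c , c∈h , y⊆c) = proj₁ (spec _) y∈s in
    proj₂ (spec _) (c , c∈h , λ v v∈z → y⊆c v (z⊆y v v∈z))

  -- The part of `h` inside `c` is a history of `c`; transitivity of `c` ensures that cutting down
  -- loses nothing below its members.
  hist-lev : ∀ {h c} → Hist h → c ∈ h → Lev c
  hist-lev {h} {c} H c∈h =
    let (k , e) = sep c (_∈ h) in
    mkLev k
      (λ x x∈k z → let (x∈c , x∈h) = proj₁ (e x) x∈k in ↔-trans (H x x∈h z) (∃-cong λ d → ×-cong
        ((λ (d∈x , d∈h) → d∈x , proj₂ (e d) (hist-transitive H c c∈h x d d∈x x∈c , d∈h)) ,
         (λ (d∈x , d∈k) → d∈x , proj₂ (proj₁ (e d) d∈k))) ↔-refl))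
      (λ z → ↔-trans (H c c∈h z) (∃-cong λ d → ×-cong (↔-sym (e d)) ↔-refl))

  lev-below : ∀ {s z} → Lev s → z ∈ s → Σ D λ r → Lev r × r ∈ s × z ⊆ r
  lev-below (mkLev h H spec) z∈s =
    let (c , c∈h , z⊆c) = proj₁ (spec _) z∈s in
    c , hist-lev H c∈h , proj₂ (spec c) (c , c∈h , λ _ m → m) , z⊆c

  Least : (D → Set) → D → Set
  Least P s = Lev s × P s × (∀ r → Lev r → P r → ¬ r ∈ s)

  opaque
    least : (P : D → Set) → {{Def₁ P}} → Σ D (λ s → Lev s × P s) → Σ D (Least P)
    least P (s , ls , Ps) with em (Σ D λ r → r ∈ s × Lev r × P r)
    ... | no ¬r = s , ls , Ps , λ r lr Pr r∈s → ¬r (r , r∈s , lr , Pr)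
    ... | yes w =
      let (r , r∈s , (lr , Pr) , min) = minimal s (λ r → Lev r × P r) w in
      r , lr , Pr , λ q lq Pq q∈r → min q q∈r (lev-transitive ls r q q∈r r∈s) (lq , Pq)

  opaque
    lev-induction : (P : D → Set) → {{Def₁ P}} →
                    (∀ s → Lev s → (∀ r → Lev r → r ∈ s → P r) → P s) → ∀ s → Lev s → P s
    lev-induction P {{dP}} step s ls = by-contradiction λ ¬Ps → contra (least (λ s → ¬ P s) {{def-→ {{dP}} }} (s , ls , ¬Ps))
      where
      contra : ¬ Σ D (Least (λ s → ¬ P s))
      contra (r , lr , ¬Pr , min) = ¬Pr (step r lr λ q lq q∈r → by-contradiction λ ¬Pq → min q lq ¬Pq q∈r)

  Comparable : D → D → Set
  Comparable s t = s ∈ t ⊎ s ≡ t ⊎ t ∈ s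

  private
    -- If `s` and `t` are incomparable, each includes the other. A member of `s` is a subset of some
    -- lower level `r` in `s`; every position of `r` relative to `t` other than `r ∈ t` would give
    -- `t ∈ s`. The other inclusion is symmetric.
    comparable-step : ∀ {s t} → Lev s → Lev t →
      (∀ r → Lev r → r ∈ s → Comparable r t) → (∀ r → Lev r → r ∈ t → Comparable s r) → Comparable s t
    comparable-step {s} {t} ls lt min-s min-t = by-contradiction λ ¬c →
      let s⊆t : s ⊆ t
          s⊆t z z∈s = let (r , lr , r∈s , z⊆r) = lev-below ls z∈s in case₁ ¬c r∈s z⊆r (min-s r lr r∈s)
          t⊆s : t ⊆ s
          t⊆s z z∈t = let (r , lr , r∈t , z⊆r) = lev-below lt z∈t in case₂ ¬c r∈t z⊆r (min-t r lr r∈t)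
      in ¬c (inj₂ (inj₁ (⊆-antisym s⊆t t⊆s)))
      where
      case₁ : ∀ {r z} → ¬ Comparable s t → r ∈ s → z ⊆ r → Comparable r t → z ∈ t
      case₁ ¬c r∈s z⊆r (inj₁ r∈t)         = lev-potent lt z⊆r r∈t
      case₁ ¬c r∈s z⊆r (inj₂ (inj₁ refl)) = ⊥-elim (¬c (inj₂ (inj₂ r∈s)))
      case₁ ¬c r∈s z⊆r (inj₂ (inj₂ t∈r))  = ⊥-elim (¬c (inj₂ (inj₂ (lev-transitive ls _ _ t∈r r∈s))))
      case₂ : ∀ {r z} → ¬ Comparable s t → r ∈ t → z ⊆ r → Comparable s r → z ∈ s
      case₂ ¬c r∈t z⊆r (inj₁ s∈r)         = ⊥-elim (¬c (inj₁ (lev-transitive lt _ _ s∈r r∈t)))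
      case₂ ¬c r∈t z⊆r (inj₂ (inj₁ refl)) = ⊥-elim (¬c (inj₁ r∈t))
      case₂ ¬c r∈t z⊆r (inj₂ (inj₂ r∈s))  = lev-potent ls z⊆r r∈s

  opaque
    comparable : ∀ {s t} → Lev s → Lev t → Comparable s t
    comparable {s} {t} ls lt = lev-induction (λ s → ∀ t → Lev t → Comparable s t)
      (λ s ls ih-s → lev-induction (Comparable s)
        λ t lt ih-t → comparable-step ls lt (λ r lr r∈s → ih-s r lr r∈s t lt) ih-t)
      s ls t lt

  opaque
    least-unique : ∀ {P s t} → Least P s → Least P t → s ≡ t
    least-unique (ls , Ps , min-s) (lt , Pt , min-t) with comparable ls lt
    ... | inj₁ s∈t        = ⊥-elim (min-t _ ls Ps s∈t)
    ... | inj₂ (inj₁ e)   = e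
    ... | inj₂ (inj₂ t∈s) = ⊥-elim (min-s _ lt Pt t∈s)

  opaque
    subsets-of-members : (h : D) → Σ D λ s → ∀ z → z ∈ s ↔ Σ D λ c → c ∈ h × z ⊆ c
    subsets-of-members h =
      let (p , p-spec) = powerSet (⋃ h)
          (s , e) = sep p (λ z → Σ D λ c → c ∈ h × z ⊆ c)
      in s , λ z → (λ m → proj₂ (proj₁ (e z) m)) ,
        λ (c , c∈h , z⊆c) → proj₂ (e z) (p-spec z (λ v v∈z → proj₂ (∈-⋃ v) (c , z⊆c v v∈z , c∈h)) , c , c∈h , z⊆c)

  opaque
    -- The levels found in `b` or in members of `b` form a history, since levels are transitive. The
    -- level with this history has every element of `b` as a member.
    lev-bound : (b : D) → (∀ v → v ∈ b → Lev v) → Σ D λ s → Lev s × b ⊆ s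
    lev-bound b lb =
      let (k , e) = sep (b ∪ ⋃ b) Lev
          (s , spec) = subsets-of-members k
          in-k : ∀ {x r} → x ∈ k → Lev r → r ∈ x → r ∈ k
          in-k {x} {r} x∈k lr r∈x = proj₂ (e r) (∪-right r (proj₂ (∈-⋃ r) (below r∈x (∈-∪ x (proj₁ (proj₁ (e x) x∈k))))) , lr)
      in s , mkLev k
           (λ x x∈k z → let lx = proj₂ (proj₁ (e x) x∈k) in
             (λ z∈x → let (r , lr , r∈x , z⊆r) = lev-below lx z∈x in r , (r∈x , in-k x∈k lr r∈x) , z⊆r) ,
             (λ (c , (c∈x , _) , z⊆c) → lev-potent lx z⊆c c∈x))
           spec ,
         λ v v∈b → proj₂ (spec v) (v , proj₂ (e v) (∪-left v v∈b , lb v v∈b) , λ _ m → m)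
      where
      below : ∀ {x r} → r ∈ x → x ∈ b ⊎ x ∈ ⋃ b → Σ D λ y → r ∈ y × y ∈ b
      below {x} r∈x (inj₁ x∈b) = x , r∈x , x∈b
      below {x} {r} r∈x (inj₂ x∈⋃) =
        let (v , x∈v , v∈b) = proj₁ (∈-⋃ x) x∈⋃ in v , lev-transitive (lb v v∈b) x r r∈x x∈v , v∈b

  -- Covering by levels, collection and reflection

  private
    Covered : D → Set
    Covered a = Σ D λ s → Lev s × a ⊆ s

    -- Sending each `x` to its least covering level is functional, so replacement applies without
    -- choice; `lev-bound` then caps the image.
    cover-step : (a : D) → (∀ x → x ∈ a → Covered x) → Covered a
    cover-step a h =
      let (b , e) = repl a (λ x → Least (x ⊆_)) λ x x∈a →
            let (v , lv) = least (x ⊆_) (h x x∈a) in v , lv , λ v′ lv′ → least-unique lv′ lv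
          (s , ls , b⊆s) = lev-bound b λ v v∈b → let (_ , _ , l , _) = proj₁ (e v) v∈b in l
      in s , ls , λ x x∈a →
        let (v , lv) = least (x ⊆_) (h x x∈a) in
        lev-potent ls (proj₁ (proj₂ lv)) (b⊆s v (proj₂ (e v) (x , x∈a , lv)))

    -- The union of all finite iterates of `⋃` on `a`, that is, its transitive closure.
    transitive-superset : (a : D) → Σ D λ t → a ⊆ t × Transitive t
    transitive-superset a =
      let (b , a∈b , closed) = Iteration.closure (λ x y → ∀ z → z ∈ y ↔ Σ D λ w → z ∈ w × w ∈ x) it
            (λ x → ⋃ x , ∈-⋃ , λ y h → ext λ z → ↔-trans (h z) (↔-sym (∈-⋃ z))) a
      in ⋃ b , (λ z z∈a → proj₂ (∈-⋃ z) (a , z∈a , a∈b)) , λ z w w∈z z∈t →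
        let (v , z∈v , v∈b) = proj₁ (∈-⋃ z) z∈t in
        proj₂ (∈-⋃ w) (⋃ v , proj₂ (∈-⋃ w) (z , w∈z , z∈v) , closed v (⋃ v) v∈b ∈-⋃)

    -- ∈-induction in the form of a minimal counterexample inside a transitive set containing `a`.
    covered : (a : D) → Covered a
    covered a = by-contradiction λ ¬ca →
      let (t , a⊆t , tt) = transitive-superset (upair a a)
          (x , x∈t , ¬cx , min) = minimal t (λ x → ¬ Covered x) (a , a⊆t a left∈upair , ¬ca)
      in ¬cx (cover-step x λ z z∈x → by-contradiction (min z z∈x (tt x z z∈x x∈t)))

  opaque
    ∈-level : (a : D) → Σ D λ s → Lev s × a ∈ s
    ∈-level a = let (s , ls , h) = covered (upair a a) in s , ls , h a left∈upair

  opaque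
    -- Scott's trick: the least level containing some value replaces the choice of a value.
    collection : (a : D) (F : D → D → Set) → Def₂ F → (∀ x → x ∈ a → Σ D (F x)) →
                 Σ D λ w → Lev w × (∀ x → x ∈ a → Σ D λ y → y ∈ w × F x y)
    collection a F dF h =
      let (b , e) = repl a (λ x → Least (λ v → Σ D λ y → y ∈ v × F x y)) λ x x∈a →
            let (v , lv) = bound x x∈a in v , lv , λ v′ lv′ → least-unique lv′ lv
          (w , lw , b⊆w) = lev-bound b λ v v∈b → let (_ , _ , l , _) = proj₁ (e v) v∈b in l
      in w , lw , λ x x∈a →
        let (v , lv@(_ , (y , y∈v , Fxy) , _)) = bound x x∈a in
        y , lev-transitive lw v y y∈v (b⊆w v (proj₂ (e v) (x , x∈a , lv))) , Fxy
      where
      instance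
        def-F : {s t : Vector D n → D} → {{DefT s}} → {{DefT t}} → Def (λ ρ → F (s ρ) (t ρ))
        def-F = def-subst₂ F dF
      bound : ∀ x → x ∈ a → Σ D (Least (λ v → Σ D λ y → y ∈ v × F x y))
      bound x x∈a = let (y , Fxy) = h x x∈a ; (s , ls , y∈s) = ∈-level y in
        least (λ v → Σ D λ y → y ∈ v × F x y) (s , ls , y , y∈s , Fxy)

  -- A definable class in which every element has an R-successor has a nonempty subset with the
  -- same property: ω steps of collection, with least levels in place of choices.
  opaque
    reflect-serial : (A : D → Set) (R : D → D → Set) → Def₁ A → Def₂ R →
                     ∀ a₀ → A a₀ → (∀ s → A s → Σ D λ t → A t × R s t) →
                     Σ D λ a → a₀ ∈ a × (∀ s → s ∈ a → A s) × (∀ s → s ∈ a → Σ D λ t → t ∈ a × R s t)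
    reflect-serial A R dA dR a₀ Aa₀ serial =
      let (b , a₀∈b , closed) = Iteration.closure (λ v → Least (Next v)) it next-functional (upair a₀ a₀)
          (a , e) = sep (⋃ b) A
      in a , proj₂ (e a₀) (proj₂ (∈-⋃ a₀) (_ , left∈upair , a₀∈b) , Aa₀) ,
         (λ s s∈a → proj₂ (proj₁ (e s) s∈a)) ,
         λ s s∈a →
           let (s∈⋃ , As) = proj₁ (e s) s∈a
               (v , s∈v , v∈b) = proj₁ (∈-⋃ s) s∈⋃
               (w , lw) = next v
               (t , t∈w , At , Rst) = proj₁ (proj₂ lw) s s∈v As
           in t , proj₂ (e t) (proj₂ (∈-⋃ t) (w , t∈w , closed v w v∈b lw) , At) , Rst
      where
      instance
        def-A : {s : Vector D n → D} → {{DefT s}} → Def (λ ρ → A (s ρ))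
        def-A = def-subst₁ A dA
        def-R : {s t : Vector D n → D} → {{DefT s}} → {{DefT t}} → Def (λ ρ → R (s ρ) (t ρ))
        def-R = def-subst₂ R dR
      -- The condition `A s` makes every set `v` have a next level, including sets not contained in
      -- `A`; iteration asks for a class function defined everywhere.
      Next : D → D → Set
      Next v w = ∀ s → s ∈ v → A s → Σ D λ t → t ∈ w × A t × R s t
      next : ∀ v → Σ D (Least (Next v))
      next v =
        let (u , e) = sep v A
            (w , lw , c) = collection u (λ s t → A t × R s t) it λ s s∈u → serial s (proj₂ (proj₁ (e s) s∈u))
        in least (Next v) (w , lw , λ s s∈v As → c s (proj₂ (e s) (s∈v , As)))
      next-functional : ∀ v → Σ D λ w → Least (Next v) w × (∀ w′ → Least (Next v) w′ → w′ ≡ w)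
      next-functional v = let (w , lw) = next v in w , lw , λ w′ lw′ → least-unique lw′ lw

-- Satisfaction in a set, defined inside N

module Truth (em : ExcludedMiddle) (𝓢 : Structure) (zf : IsZF 𝓢) where
  open Levels em 𝓢 zf public

  private
    variable
      n : ℕ

  -- Assignments are sets of pairs (key , value); Update x′ x k y says x′ = x[k ≔ y].
  record Update (x′ x k y : D) : Set where
    constructor mkUpdate
    field
      spec : ∀ p → p ∈ x′ ↔ (p ≡ opair k y ⊎ (p ∈ x × ¬ Σ D λ a → p ≡ opair k a))

  private
    def-Update₄ : Def {4} (λ ρ → Update (ρ zero) (ρ (suc zero)) (ρ (suc (suc zero))) (ρ (suc (suc (suc zero)))))
    def-Update₄ = def-↔
      {P = λ ρ → ∀ p → p ∈ ρ zero ↔ (p ≡ opair (ρ (suc (suc zero))) (ρ (suc (suc (suc zero)))) ⊎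
                 (p ∈ ρ (suc zero) × ¬ Σ D λ a → p ≡ opair (ρ (suc (suc zero))) a))}
      (λ ρ → mkUpdate , Update.spec) it

  instance
    def-Update : {s t u v : Vector D n → D} → {{DefT s}} → {{DefT t}} → {{DefT u}} → {{DefT v}} →
                 Def (λ ρ → Update (s ρ) (t ρ) (u ρ) (v ρ))
    def-Update = def-subst₄ Update def-Update₄

  opaque
    update : ∀ x k y → Σ D λ x′ → Update x′ x k y
    update x k y =
      let (u , e) = sep x (λ p → ¬ Σ D λ a → p ≡ opair k a) in
      upair (opair k y) (opair k y) ∪ u , mkUpdate λ p →
        (λ m → map-⊎ ∈-singleton (proj₁ (e p)) (∈-∪ p m)) ,
        [ (λ { refl → ∪-left p left∈upair }) , (λ m → ∪-right p (proj₂ (e p) m)) ]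

  lookup-updated : ∀ {x′ x k y} → Update x′ x k y → ∀ a → opair k a ∈ x′ ↔ a ≡ y
  lookup-updated {x′} {x} {k} {y} (mkUpdate spec) a =
    (λ m → [ opair-injʳ , (λ (_ , ¬k) → ⊥-elim (¬k (a , refl))) ] (proj₁ (spec _) m)) ,
    (λ { refl → proj₂ (spec _) (inj₁ refl) })

  lookup-other : ∀ {x′ x k y l} → Update x′ x k y → ¬ l ≡ k → ∀ a → opair l a ∈ x′ ↔ opair l a ∈ x
  lookup-other (mkUpdate spec) l≢k a =
    (λ m → [ (λ e → ⊥-elim (l≢k (opair-injˡ e))) , proj₁ ] (proj₁ (spec _) m)) ,
    (λ m → proj₂ (spec _) (inj₂ (m , λ (b , e) → l≢k (opair-injˡ e))))

  Atom : D → D → D → Set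
  Atom k l x = Σ D λ a → Σ D λ b → opair k a ∈ x × opair l b ∈ x × a ∈ b

  𝟙 : D
  𝟙 = upair ∅ ∅

  ∅≢𝟙 : ¬ ∅ ≡ 𝟙
  ∅≢𝟙 e = ∉∅ ∅ (subst (∅ ∈_) (sym e) left∈upair)

  -- atomᶜ k l codes "x(k) ∈ x(l)" and nexᶜ k d e codes "there is no y with (d ∧ e)(x[k ≔ y])".
  atomᶜ : D → D → D
  atomᶜ k l = opair ∅ (opair k l)

  nexᶜ : D → D → D → D
  nexᶜ k d e = opair 𝟙 (opair k (opair d e))

  -- Value g c X: X is the set of the assignments in g satisfying c, quantifiers ranging over
  -- updates in g.
  private
    J : D → D → D → Set
    J g f p =
      (Σ D λ k → Σ D λ l → Σ D λ X → p ≡ opair (atomᶜ k l) X × (∀ x → x ∈ X ↔ (x ∈ g × Atom k l x))) ⊎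
      (Σ D λ k → Σ D λ d → Σ D λ e → Σ D λ X → Σ D λ Y → Σ D λ Z →
         p ≡ opair (nexᶜ k d e) X × opair d Y ∈ f × opair e Z ∈ f ×
         (∀ x → x ∈ X ↔ (x ∈ g × ¬ Σ D λ x′ → x′ ∈ g × (Σ D λ y → Update x′ x k y) × x′ ∈ Y × x′ ∈ Z)))

    module Val = Derivation J
      (λ s → map-⊎ (λ e → e) λ (k , d , e , X , Y , Z , eq , mY , mZ , h) → k , d , e , X , Y , Z , eq , s _ mY , s _ mZ , h)

    def-J₃ : Def {3} (λ ρ → J (ρ zero) (ρ (suc zero)) (ρ (suc (suc zero))))
    def-J₃ = it

    instance
      def-Val : {s t : Vector D n → D} → {{DefT s}} → {{DefT t}} → Def (λ ρ → Val.Derivable (s ρ) (t ρ))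
      def-Val = Val.def-Derivable def-J₃

  Value : D → D → D → Set
  Value g c X = Val.Derivable g (opair c X)

  record True (g c x : D) : Set where
    constructor mkTrue
    field
      value    : D
      isValue  : Value g c value
      ∈value   : x ∈ value

  private
    def-True₃ : Def {3} (λ ρ → True (ρ zero) (ρ (suc zero)) (ρ (suc (suc zero))))
    def-True₃ = def-↔ {P = λ ρ → Σ D λ X → Value (ρ zero) (ρ (suc zero)) X × ρ (suc (suc zero)) ∈ X}
      (λ ρ → (λ (X , v , m) → mkTrue X v m) , (λ (mkTrue X v m) → X , v , m)) it

  instance
    def-True : {s t u : Vector D n → D} → {{DefT s}} → {{DefT t}} → {{DefT u}} → Def (λ ρ → True (s ρ) (t ρ) (u ρ))
    def-True = def-subst₃ True def-True₃

  -- The codes built in finitely many steps; an ω-nonstandard model has further ones, about which nothing is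
  -- claimed.
  data Code : D → Set where
    atom : ∀ k l → Code (atomᶜ k l)
    nex  : ∀ k {d e} → Code d → Code e → Code (nexᶜ k d e)

  Unique-value : D → D → Set
  Unique-value g c = Σ D λ X → Value g c X × (∀ X′ → Value g c X′ → X′ ≡ X)

  private
    atom-inv : ∀ {g k l X} → Value g (atomᶜ k l) X → ∀ x → x ∈ X ↔ (x ∈ g × Atom k l x)
    atom-inv v with Val.invert v
    ... | _ , inj₁ (k , l , X , eq , h) , _ with opair-inj eq
    ... | eq′ , refl with opair-inj (opair-injʳ eq′)
    ... | refl , refl = h
    atom-inv v | _ , inj₂ (k , d , e , X , Y , Z , eq , _) , _ = ⊥-elim (∅≢𝟙 (opair-injˡ (opair-injˡ eq)))

    nex-inv : ∀ {g k d e X} → Value g (nexᶜ k d e) X → Σ D λ Y → Σ D λ Z → Value g d Y × Value g e Z ×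
              (∀ x → x ∈ X ↔ (x ∈ g × ¬ Σ D λ x′ → x′ ∈ g × (Σ D λ y → Update x′ x k y) × x′ ∈ Y × x′ ∈ Z))
    nex-inv v with Val.invert v
    ... | _ , inj₁ (k , l , X , eq , h) , _ = ⊥-elim (∅≢𝟙 (sym (opair-injˡ (opair-injˡ eq))))
    ... | _ , inj₂ (k , d , e , X , Y , Z , eq , mY , mZ , h) , ds with opair-inj eq
    ... | eq′ , refl with opair-inj (opair-injʳ eq′)
    ... | refl , eq″ with opair-inj eq″
    ... | refl , refl = Y , Z , ds _ mY , ds _ mZ , h

    atom-value : ∀ g k l → Unique-value g (atomᶜ k l)
    atom-value g k l = let (X , h) = sep g (Atom k l) in
      X , Val.derive ∅ Val.∅-closed (inj₁ (k , l , X , refl , h)) ,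
      λ X′ v → ext λ x → ↔-trans (atom-inv v x) (↔-sym (h x))

    nex-value : ∀ {g d e} k → Unique-value g d → Unique-value g e → Unique-value g (nexᶜ k d e)
    nex-value {g} {d} {e} k (Y , Val.derivable f mY cY , uY) (Z , Val.derivable f′ mZ cZ , uZ) =
      let (X , h) = sep g (λ x → ¬ Σ D λ x′ → x′ ∈ g × (Σ D λ y → Update x′ x k y) × x′ ∈ Y × x′ ∈ Z) in
      X , Val.derive (f ∪ f′) (Val.closed-∪ cY cZ)
            (inj₂ (k , d , e , X , Y , Z , refl , ∪-left _ mY , ∪-right _ mZ , h)) ,
      λ X′ v → unique h (nex-inv v)
      where
      unique : ∀ {X X′} →
        (∀ x → x ∈ X ↔ (x ∈ g × ¬ Σ D λ x′ → x′ ∈ g × (Σ D λ y → Update x′ x k y) × x′ ∈ Y × x′ ∈ Z)) →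
        (Σ D λ Y′ → Σ D λ Z′ → Value g d Y′ × Value g e Z′ ×
          (∀ x → x ∈ X′ ↔ (x ∈ g × ¬ Σ D λ x′ → x′ ∈ g × (Σ D λ y → Update x′ x k y) × x′ ∈ Y′ × x′ ∈ Z′))) →
        X′ ≡ X
      unique h (Y′ , Z′ , vY′ , vZ′ , h′) with uY Y′ vY′ | uZ Z′ vZ′
      ... | refl | refl = ext λ x → ↔-trans (h′ x) (↔-sym (h x))

  opaque
    -- External induction along `Code`; the derivation trees of the two components are united into
    -- one for the compound.
    unique-value : ∀ {c} → Code c → ∀ g → Unique-value g c
    unique-value (atom k l)  g = atom-value g k l
    unique-value (nex k d e) g = nex-value k (unique-value d g) (unique-value e g)

  true-via : ∀ {g c X} → Code c → Value g c X → ∀ x → x ∈ X ↔ True g c x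
  true-via {g} {c} {X} cc v x = mkTrue X v , λ (mkTrue X′ v′ m) →
    subst (x ∈_) (trans (proj₂ (proj₂ (unique-value cc g)) X′ v′) (sym (proj₂ (proj₂ (unique-value cc g)) X v))) m

  true-atom : ∀ {g k l} x → True g (atomᶜ k l) x ↔ (x ∈ g × Atom k l x)
  true-atom {g} {k} {l} x = let (X , v , _) = unique-value (atom k l) g in
    ↔-trans (↔-sym (true-via (atom k l) v x)) (atom-inv v x)

  Witness : (g k d e x x′ : D) → Set
  Witness g k d e x x′ = (Σ D λ y → Update x′ x k y) × True g d x′ × True g e x′

  true-nex : ∀ {g k d e} → Code d → Code e → ∀ x →
             True g (nexᶜ k d e) x ↔ (x ∈ g × ¬ Σ D λ x′ → x′ ∈ g × Witness g k d e x x′)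
  true-nex {g} {k} {d} {e} cd ce x =
    let (X , v , _) = unique-value (nex k cd ce) g
        (Y , Z , vY , vZ , h) = nex-inv v
    in ↔-trans (↔-sym (true-via (nex k cd ce) v x)) (↔-trans (h x)
      (×-cong ↔-refl (→-cong (∃-cong λ x′ → ×-cong ↔-refl (×-cong ↔-refl
        (×-cong (true-via cd vY x′) (true-via ce vZ x′)))) ↔-refl)))

  -- Witness levels and descents

  -- An existential statement and its assignment are packed into one set, so that a single element
  -- can index a step of descent.
  nameᶜ : D → D → D → D → D
  nameᶜ k d e x = opair k (opair d (opair e x))

  record NamedWitness (g b x′ : D) : Set where
    constructor mkWitness
    field
      {k d e x} : D
      name      : b ≡ nameᶜ k d e x
      witness   : Witness g k d e x x′

  private
    def-NamedWitness₃ : Def {3} (λ ρ → NamedWitness (ρ zero) (ρ (suc zero)) (ρ (suc (suc zero))))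
    def-NamedWitness₃ = def-↔
      {P = λ ρ → Σ D λ k → Σ D λ d → Σ D λ e → Σ D λ x →
         ρ (suc zero) ≡ nameᶜ k d e x × Witness (ρ zero) k d e x (ρ (suc (suc zero)))}
      (λ ρ → (λ (k , d , e , x , p , q) → mkWitness p q) , (λ (mkWitness p q) → _ , _ , _ , _ , p , q)) it

  instance
    def-NamedWitness : {s t u : Vector D n → D} → {{DefT s}} → {{DefT t}} → {{DefT u}} →
                       Def (λ ρ → NamedWitness (s ρ) (t ρ) (u ρ))
    def-NamedWitness = def-subst₃ NamedWitness def-NamedWitness₃

  unname : ∀ {g k d e x x′} → NamedWitness g (nameᶜ k d e x) x′ → Witness g k d e x x′
  unname (mkWitness eq w) with opair-inj eq
  ... | refl , eq′ with opair-inj eq′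
  ... | refl , eq″ with opair-inj eq″
  ... | refl , refl = w

  -- Inclusion `x′ ⊆ w` is used instead of membership, so that a bounding level exists inside `g`
  -- even when `g` is a successor level.
  Bounds : (g b w : D) → Set
  Bounds g b w = Σ D λ x′ → x′ ∈ g × x′ ⊆ w × NamedWitness g b x′

  record WitnessLevel (g b w : D) : Set where
    constructor mkWitnessLevel
    field
      isLeast : Least (Bounds g b) w

  private
    def-WitnessLevel₃ : Def {3} (λ ρ → WitnessLevel (ρ zero) (ρ (suc zero)) (ρ (suc (suc zero))))
    def-WitnessLevel₃ = def-↔ {P = λ ρ → Least (Bounds (ρ zero) (ρ (suc zero))) (ρ (suc (suc zero)))}
      (λ ρ → mkWitnessLevel , WitnessLevel.isLeast) it

  instance
    def-WitnessLevel : {s t u : Vector D n → D} → {{DefT s}} → {{DefT t}} → {{DefT u}} →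
                       Def (λ ρ → WitnessLevel (s ρ) (t ρ) (u ρ))
    def-WitnessLevel = def-subst₃ WitnessLevel def-WitnessLevel₃

  witnessLevel-unique : ∀ {g b w w′} → WitnessLevel g b w → WitnessLevel g b w′ → w ≡ w′
  witnessLevel-unique (mkWitnessLevel l) (mkWitnessLevel l′) = least-unique l l′

  opaque
    -- `lev-below` yields one bounding level `r` in `g`. The least bound is not above `r`, hence
    -- lies in `g` too.
    witnessLevel : ∀ {g b x′} → Lev g → x′ ∈ g → NamedWitness g b x′ → Σ D λ w → WitnessLevel g b w × w ∈ g
    witnessLevel {g} {b} {x′} lg x′∈g nw =
      let (r , lr , r∈g , x′⊆r) = lev-below lg x′∈g in
      below lr r∈g (x′ , x′∈g , x′⊆r , nw) (least (Bounds g b) (r , lr , x′ , x′∈g , x′⊆r , nw))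
      where
      below : ∀ {r} → Lev r → r ∈ g → Bounds g b r → Σ D (Least (Bounds g b)) → Σ D λ w → WitnessLevel g b w × w ∈ g
      below {r} lr r∈g br (w , l@(lw , _ , min)) = w , mkWitnessLevel l ,
        [ (λ w∈r → lev-transitive lg r w w∈r r∈g) , [ (λ { refl → r∈g }) , (λ r∈w → ⊥-elim (min r lr br r∈w)) ] ]
          (comparable lw lr)

  private
    JR : D → D → D → Set
    JR g₀ f p = p ≡ opair ∅ g₀ ⊎
      Σ D λ s → Σ D λ b → Σ D λ g → Σ D λ w → p ≡ opair (opair s b) w × opair s g ∈ f × WitnessLevel g b w

    module Rch = Derivation JR
      (λ s → map-⊎ (λ e → e) λ (s′ , b , g , w , e , m , h) → s′ , b , g , w , e , s _ m , h)

    def-JR₃ : Def {3} (λ ρ → JR (ρ zero) (ρ (suc zero)) (ρ (suc (suc zero))))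
    def-JR₃ = it

  -- Reach g₀ s v: starting from g₀, passing successively to the witness levels of the names
  -- b₁ , … , bₖ listed in s = ((∅ , b₁) , … , bₖ) leads to v.
  record Reach (g₀ s v : D) : Set where
    constructor mkReach
    field
      derivation : Rch.Derivable g₀ (opair s v)

  private
    instance
      def-Rch : {s t : Vector D n → D} → {{DefT s}} → {{DefT t}} → Def (λ ρ → Rch.Derivable (s ρ) (t ρ))
      def-Rch = Rch.def-Derivable def-JR₃

    def-Reach₃ : Def {3} (λ ρ → Reach (ρ zero) (ρ (suc zero)) (ρ (suc (suc zero))))
    def-Reach₃ = def-↔ {P = λ ρ → Rch.Derivable (ρ zero) (opair (ρ (suc zero)) (ρ (suc (suc zero))))}
      (λ ρ → mkReach , Reach.derivation) it

  instance
    def-Reach : {s t u : Vector D n → D} → {{DefT s}} → {{DefT t}} → {{DefT u}} → Def (λ ρ → Reach (s ρ) (t ρ) (u ρ))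
    def-Reach = def-subst₃ Reach def-Reach₃

  reach-start : ∀ {g₀} → Reach g₀ ∅ g₀
  reach-start = mkReach (Rch.derive ∅ Rch.∅-closed (inj₁ refl))

  reach-step : ∀ {g₀ s b g w} → Reach g₀ s g → WitnessLevel g b w → Reach g₀ (opair s b) w
  reach-step (mkReach (Rch.derivable f m c)) h = mkReach (Rch.derive f c (inj₂ (_ , _ , _ , _ , refl , m , h)))

  reach-lev : ∀ {g₀ s v} → Lev g₀ → Reach g₀ s v → Lev v
  reach-lev lg (mkReach d) with Rch.invert d
  ... | _ , inj₁ e , _ = subst Lev (sym (opair-injʳ e)) lg
  ... | _ , inj₂ (_ , _ , _ , _ , e , _ , mkWitnessLevel l) , _ = subst Lev (sym (opair-injʳ e)) (proj₁ l)

  private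
    ∅≢opair : ∀ {a b} → ¬ ∅ ≡ opair a b
    ∅≢opair e = ∉∅ _ (subst (_ ∈_) (sym e) singleton∈opair)

    reach-unique-step : ∀ {g₀ s v v′} →
      (∀ s₁ b → s ≡ opair s₁ b → ∀ g g′ → Reach g₀ s₁ g → Reach g₀ s₁ g′ → g ≡ g′) →
      Reach g₀ s v → Reach g₀ s v′ → v ≡ v′
    reach-unique-step ih (mkReach d) (mkReach d′) with Rch.invert d | Rch.invert d′
    ... | _ , inj₁ e , _ | _ , inj₁ e′ , _ = trans (opair-injʳ e) (sym (opair-injʳ e′))
    ... | _ , inj₁ e , _ | _ , inj₂ (_ , _ , _ , _ , e′ , _) , _ =
      ⊥-elim (∅≢opair (trans (sym (opair-injˡ e)) (opair-injˡ e′)))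
    ... | _ , inj₂ (_ , _ , _ , _ , e , _) , _ | _ , inj₁ e′ , _ =
      ⊥-elim (∅≢opair (trans (sym (opair-injˡ e′)) (opair-injˡ e)))
    ... | _ , inj₂ (s₁ , b , g , w , e , m , h) , ds | _ , inj₂ (s₁′ , b′ , g′ , w′ , e′ , m′ , h′) , ds′
      with opair-inj e | opair-inj e′
    ... | refl , refl | e″ , refl with opair-inj e″
    ... | refl , refl with ih s₁ b refl g g′ (mkReach (ds _ m)) (mkReach (ds′ _ m′))
    ... | refl = witnessLevel-unique h h′

  opaque
    -- Induction on a level containing the list `s`. The shortened list `s₁` lies in a lower level
    -- because its singleton is a member of the pair `s`.
    reach-unique : ∀ {g₀ s v v′} → Reach g₀ s v → Reach g₀ s v′ → v ≡ v′
    reach-unique {g₀} {s} {v} {v′} ρ ρ′ = let (r , lr , s∈r) = ∈-level s in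
      lev-induction (λ r → ∀ s → s ∈ r → ∀ v v′ → Reach g₀ s v → Reach g₀ s v′ → v ≡ v′)
        (λ r lr ih s s∈r v v′ → reach-unique-step λ { s₁ b refl g g′ →
          let (q , lq , q∈r , s⊆q) = lev-below lr s∈r in
          ih q lq q∈r s₁ (lev-transitive lq (upair s₁ s₁) s₁ left∈upair (s⊆q _ singleton∈opair)) g g′ })
        r lr s s∈r v v′ ρ ρ′

-- Absoluteness between M and N

module ConservativeEndExtension (em : ExcludedMiddle) (𝓜 𝓝 : Structure) (zfᴹ : IsZF 𝓜) (zfᴺ : IsZF 𝓝)
  (ι : Dom 𝓜 → Dom 𝓝) (end : IsEndExtension 𝓜 𝓝 ι) (conservative : IsConservative 𝓜 𝓝 ι) where

  module M = Levels em 𝓜 zfᴹ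
  open Truth em 𝓝 zfᴺ

  InM : D → Set
  InM y = Σ M.D λ x → ι x ≡ y

  ι-injective : ∀ {a b} → ι a ≡ ι b → a ≡ b
  ι-injective = proj₁ (proj₁ end) _ _

  ι-∈ : ∀ {a b} → a M.∈ b ↔ ι a ∈ ι b
  ι-∈ = ⇔⇒↔ (proj₂ (proj₁ end) _ _)

  ∈ι⇒InM : ∀ {y a} → y ∈ ι a → InM y
  ∈ι⇒InM = proj₂ end _ _

  ι-ext : ∀ {a b} → (∀ x → ι x ∈ ι a ↔ ι x ∈ b) → (∀ y → y ∈ b → InM y) → ι a ≡ b
  ι-ext {a} {b} e h = ext λ y →
    (λ m → let (x , p) = ∈ι⇒InM m in subst (_∈ b) p (proj₁ (e x) (subst (_∈ ι a) (sym p) m))) ,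
    (λ m → let (x , p) = h y m in subst (_∈ ι a) p (proj₂ (e x) (subst (_∈ b) (sym p) m)))

  ι-⊆ : ∀ {a b} → a M.⊆ b ↔ ι a ⊆ ι b
  ι-⊆ {a} {b} =
    (λ s y m → let (x , p) = ∈ι⇒InM m in subst (_∈ ι b) p (proj₁ ι-∈ (s x (proj₂ ι-∈ (subst (_∈ ι a) (sym p) m))))) ,
    (λ s x m → proj₂ ι-∈ (s (ι x) (proj₁ ι-∈ m)))

  ι-∅ : ι M.∅ ≡ ∅
  ι-∅ = ∅-unique λ z m → let (x , p) = ∈ι⇒InM m in M.∉∅ x (proj₂ ι-∈ (subst (_∈ ι M.∅) (sym p) m))

  ι-upair : ∀ {a b} → ι (M.upair a b) ≡ upair (ι a) (ι b)
  ι-upair {a} {b} = ι-ext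
    (λ x → ↔-trans (↔-sym ι-∈) (↔-trans (M.∈-upair x)
      (↔-trans (⊎-cong (cong ι , ι-injective) (cong ι , ι-injective)) (↔-sym (∈-upair (ι x))))))
    (λ y m → [ (λ e → a , sym e) , (λ e → b , sym e) ] (proj₁ (∈-upair y) m))

  ι-opair : ∀ {a b} → ι (M.opair a b) ≡ opair (ι a) (ι b)
  ι-opair = trans (cong ι M.opair-as-upair) (trans ι-upair (trans (cong₂ upair ι-upair ι-upair) (sym opair-as-upair)))

  InM-opairʳ : ∀ {a b} → InM (opair a b) → InM b
  InM-opairʳ {a} {b} (p , e) =
    let (q , e′) = ∈ι⇒InM (subst (upair a b ∈_) (trans (sym opair-as-upair) (sym e)) right∈upair) in
    ∈ι⇒InM (subst (b ∈_) (sym e′) right∈upair)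

  conservative₁ : (P : D → Set) → Def₁ P → M.Def₁ (λ x → P (ι x))
  conservative₁ P (mkDef {m} φ q d) =
    let (m′ , ψ , p , e) = conservative m φ q in
    M.mkDef ψ p λ ρ → ↔-trans (d (λ _ → ι (ρ zero))) (⇔⇒↔ (e (ρ zero)))

  -- Conservativity is stated for subsets of M; a binary relation is coded as a class of ordered
  -- pairs, which `ι` preserves.
  conservative₂ : (R : D → D → Set) → Def₂ R → M.Def₂ (λ s t → R (ι s) (ι t))
  conservative₂ R dR = M.def-↔
    (λ ρ → (λ (s , t , e , r) → let (p , q) = opair-inj (trans (sym ι-opair) e) in subst₂ R (sym p) (sym q) r) ,
           (λ r → _ , _ , ι-opair , r))
    (M.def-subst₁ (λ z → Coded (ι z)) (conservative₁ Coded it) {s = λ ρ → M.opair (ρ zero) (ρ (suc zero))})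
    where
    Coded : D → Set
    Coded z = Σ D λ s → Σ D λ t → z ≡ opair s t × R s t
    instance
      def-R : ∀ {n} {s t : Vector D n → D} → {{DefT s}} → {{DefT t}} → Def (λ ρ → R (s ρ) (t ρ))
      def-R = def-subst₂ R dR

  opaque
    -- The trace of `y` on M is M-definable by conservativity, so separation in M carves a copy of
    -- `y` out of `a`.
    subset-InM : ∀ {y a} → y ⊆ ι a → InM y
    subset-InM {y} {a} h =
      let (b , e) = M.sep a (λ x → ι x ∈ y) {{conservative₁ (_∈ y) it}} in
      b , ι-ext (λ x → (λ m → proj₂ (proj₁ (e x) (proj₂ ι-∈ m))) , (λ m → proj₁ ι-∈ (proj₂ (e x) (proj₂ ι-∈ (h _ m) , m))))
                (λ z m → ∈ι⇒InM (h z m))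

  private
    -- Absoluteness of the clause common to `Hist` and `Lev`. From right to left, an N-subset of an
    -- element of M is first brought into M by `subset-InM`.
    members-ι : ∀ {x} {C : M.D → Set} {C′ : D → Set} →
      (∀ c → C c → C′ (ι c)) → (∀ c → C′ c → Σ M.D λ c₀ → ι c₀ ≡ c × C c₀) →
      (∀ z → z M.∈ x ↔ Σ M.D λ c → C c × z M.⊆ c) → ∀ z → z ∈ ι x ↔ Σ D λ c → C′ c × z ⊆ c
    members-ι {x} {C} {C′} up down spec z =
      (λ m → into m (∈ι⇒InM m)) , (λ (c , C′c , z⊆c) → back z⊆c (down c C′c))
      where
      into : ∀ {z} → z ∈ ι x → InM z → Σ D λ c → C′ c × z ⊆ c
      into m (z , refl) = let (c , Cc , s) = proj₁ (spec z) (proj₂ ι-∈ m) in ι c , up c Cc , proj₁ ι-⊆ s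
      back′ : ∀ {z c} → z ⊆ ι c → C c → InM z → z ∈ ι x
      back′ {c = c} s Cc (z , refl) = proj₁ ι-∈ (proj₂ (spec z) (c , Cc , proj₂ ι-⊆ s))
      back : ∀ {z c} → z ⊆ c → Σ M.D (λ c₀ → ι c₀ ≡ c × C c₀) → z ∈ ι x
      back s (c , refl , Cc) = back′ s Cc (subset-InM s)

  lev-ι : ∀ {s} → M.Lev s → Lev (ι s)
  lev-ι (M.mkLev h H spec) = mkLev (ι h)
    (λ x m → hist m (∈ι⇒InM m))
    (members-ι (λ c → proj₁ ι-∈) (λ c m → let (c₀ , e) = ∈ι⇒InM m in c₀ , e , proj₂ ι-∈ (subst (_∈ ι h) (sym e) m)) spec)
    where
    hist : ∀ {x} → x ∈ ι h → InM x → ∀ z → z ∈ x ↔ Σ D λ c → (c ∈ x × c ∈ ι h) × z ⊆ c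
    hist m (x , refl) = members-ι
      (λ c (p , q) → proj₁ ι-∈ p , proj₁ ι-∈ q)
      (λ c (p , q) → let (c₀ , e) = ∈ι⇒InM p in
        c₀ , e , proj₂ ι-∈ (subst (_∈ ι x) (sym e) p) , proj₂ ι-∈ (subst (_∈ ι h) (sym e) q))
      (H x (proj₂ ι-∈ m))

  -- Compare `g` with the image of a level of M containing `x`: were `g` equal to that image or a
  -- member of it, `g` would be in M.
  new-level-contains-M : ∀ {g} → Lev g → ¬ InM g → ∀ x → ι x ∈ g
  new-level-contains-M {g} lg g∉M x =
    let (s , ls , x∈s) = M.∈-level x in
    [ lev-transitive lg (ι s) (ι x) (proj₁ ι-∈ x∈s)
    , [ (λ e → ⊥-elim (g∉M (s , e))) , (λ g∈s → ⊥-elim (g∉M (∈ι⇒InM g∈s))) ] ] (comparable (lev-ι ls) lg)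

  -- M is closed under witnesses for truth in g, i.e. M is an elementary substructure of (g , ∈).
  Good : D → Set
  Good g = ∀ b x′ → x′ ∈ g → NamedWitness g (ι b) x′ → Σ M.D λ x″ → NamedWitness g (ι b) (ι x″)

  -- Descent from levels that are not good

  opaque
    -- Badness gives a name with a witness in `g` but none in M. If its least witness level were in
    -- M, the witness included in that level would be in M by `subset-InM`.
    bad-descends : ∀ {g} → Lev g → ¬ InM g → ¬ Good g → Σ M.D λ b → Σ D λ w → WitnessLevel g (ι b) w × w ∈ g × ¬ InM w
    bad-descends {g} lg g∉M bad =
      from-bad (by-contradiction λ h → bad λ b x′ x′∈g nw → by-contradiction λ ¬x″ → h (b , x′ , x′∈g , nw , ¬x″))
      where
      from-bad : Σ M.D (λ b → Σ D λ x′ → x′ ∈ g × NamedWitness g (ι b) x′ × ¬ Σ M.D λ x″ → NamedWitness g (ι b) (ι x″)) →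
                 Σ M.D λ b → Σ D λ w → WitnessLevel g (ι b) w × w ∈ g × ¬ InM w
      from-bad (b , x′ , x′∈g , nw , ¬x″) = let (w , wl , w∈g) = witnessLevel lg x′∈g nw in
        b , w , wl , w∈g , new wl
        where
        new : ∀ {w} → WitnessLevel g (ι b) w → ¬ InM w
        new (mkWitnessLevel (_ , (x₁ , _ , x₁⊆w , nw₁) , _)) (u , refl) =
          let (x″ , e) = subset-InM x₁⊆w in ¬x″ (x″ , subst (NamedWitness g (ι b)) (sym e) nw₁)

  module Descent (g₀ : D) (lg₀ : Lev g₀) (g₀∉M : ¬ InM g₀) (all-bad : ∀ g → Lev g → ¬ InM g → ¬ Good g) where

    -- The elements of M naming levels outside M.
    Name : M.D → Set
    Name s = (Σ D λ v → Reach g₀ (ι s) v) × ¬ Σ M.D λ v → Reach g₀ (ι s) (ι v)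

    _↘_ : M.D → M.D → Set
    s ↘ t = Σ D λ v → Σ D λ w → Reach g₀ (ι s) v × Reach g₀ (ι t) w × w ∈ v

    -- The second half of `Name` quantifies over M, and no definition of `InM` in N is at hand. So
    -- conservativity is applied to the relation `Reach`, and the quantifier is added afterwards in
    -- M.
    def-Name : M.Def₁ Name
    def-Name = M.def-×
      {{conservative₁ (λ s → Σ D λ v → Reach g₀ s v) it}}
      {{M.def-→ {{M.def-∃ {P = λ v ρ → Reach g₀ (ι (ρ zero)) (ι v)}
                   {{conservative₂ (λ v s → Reach g₀ s v) it}} }} }}

    def-↘ : M.Def₂ _↘_
    def-↘ = conservative₂ (λ s t → Σ D λ v → Σ D λ w → Reach g₀ s v × Reach g₀ t w × w ∈ v) it

    name-intro : ∀ {s v} → Reach g₀ (ι s) v → ¬ InM v → Name s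
    name-intro r v∉M = (_ , r) , λ (u , r′) → v∉M (u , reach-unique r′ r)

    name-serial : ∀ s → Name s → Σ M.D λ t → Name t × s ↘ t
    name-serial s ((v , r) , ¬v) = extend (bad-descends (reach-lev lg₀ r) v∉M (all-bad v (reach-lev lg₀ r) v∉M))
      where
      v∉M : ¬ InM v
      v∉M (u , e) = ¬v (u , subst (Reach g₀ (ι s)) (sym e) r)
      extend : (Σ M.D λ b → Σ D λ w → WitnessLevel v (ι b) w × w ∈ v × ¬ InM w) → Σ M.D λ t → Name t × s ↘ t
      extend (b , w , wl , w∈v , w∉M) =
        let r′ = subst (λ t → Reach g₀ t w) (sym ι-opair) (reach-step r wl) in
        M.opair s b , name-intro r′ w∉M , v , w , r , r′ , w∈v

    -- Reflection takes place in M and acts on names; replacement in N along `Reach` then collects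
    -- the named levels. The empty list names `g₀`, which makes that set nonempty.
    contradiction : ⊥
    contradiction = no-descent (M.reflect-serial Name _↘_ def-Name def-↘ M.∅
      (name-intro (subst (λ s → Reach g₀ s g₀) (sym ι-∅) reach-start) g₀∉M) name-serial)
      where
      no-descent : ¬ Σ M.D λ a → M.∅ M.∈ a × (∀ s → s M.∈ a → Name s) × (∀ s → s M.∈ a → Σ M.D λ t → t M.∈ a × s ↘ t)
      no-descent (a , ∅∈a , a⊆Name , serial) = no-min (repl (ι a) (Reach g₀) λ s m → total (∈ι⇒InM m) m)
        where
        total : ∀ {s} → InM s → s ∈ ι a → Σ D λ v → Reach g₀ s v × (∀ v′ → Reach g₀ s v′ → v′ ≡ v)
        total (s , refl) m = let ((v , r) , _) = a⊆Name s (proj₂ ι-∈ m) in v , r , λ v′ r′ → reach-unique r′ r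
        no-min : ¬ Σ D λ c → ∀ v → v ∈ c ↔ Σ D λ s → s ∈ ι a × Reach g₀ s v
        no-min (c , e) =
          let ((v₀ , r₀) , _) = a⊆Name M.∅ ∅∈a in
          lower (IsZF.foundation zfᴺ c (v₀ , proj₂ (e v₀) (_ , proj₁ ι-∈ ∅∈a , r₀)))
          where
          lower′ : ∀ {v s} → ¬ Σ D (λ w → w ∈ v × w ∈ c) → InM s → s ∈ ι a → Reach g₀ s v → ⊥
          lower′ min (s , refl) m r =
            let (t , t∈a , v′ , w , r′ , r″ , w∈v′) = serial s (proj₂ ι-∈ m) in
            min (w , subst (w ∈_) (reach-unique r′ r) w∈v′ , proj₂ (e w) (ι t , proj₁ ι-∈ t∈a , r″))
          lower : ¬ Σ D λ v → v ∈ c × ¬ Σ D λ w → w ∈ v × w ∈ c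
          lower (v , v∈c , min) = let (s , m , r) = proj₁ (e v) v∈c in lower′ min (∈ι⇒InM m) m r

  opaque
    -- Properness supplies the start of the descent: a level containing a new element cannot itself
    -- be in M.
    good-level-exists : IsProper 𝓜 𝓝 ι → Σ D λ g → Lev g × ¬ InM g × Good g
    good-level-exists (y , y∉M) = by-contradiction λ h →
      let (g₀ , lg₀ , y∈g₀) = ∈-level y in
      Descent.contradiction g₀ lg₀ (λ (u , e) → y∉M (∈ι⇒InM (subst (y ∈_) (sym e) y∈g₀))) λ g lg g∉M good → h (g , lg , g∉M , good)

  -- Variables and assignments coded in M

  -- Zermelo numerals serve as names of variables.
  key : ℕ → M.D
  key zero    = M.∅
  key (suc m) = M.upair (key m) (key m)

  key-injective : ∀ l m → key l ≡ key m → l ≡ m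
  key-injective zero    zero    e = refl
  key-injective zero    (suc m) e = ⊥-elim (M.∉∅ _ (subst (key m M.∈_) (sym e) M.left∈upair))
  key-injective (suc l) zero    e = ⊥-elim (M.∉∅ _ (subst (key l M.∈_) e M.left∈upair))
  key-injective (suc l) (suc m) e =
    cong suc (key-injective l m (M.∈-singleton (subst (key l M.∈_) e M.left∈upair)))

  private
    variable
      n : ℕ

  -- De Bruijn variable `i` is stored under the key numbered `ks i`; the content of `x` at other
  -- keys is left open.
  Represents : Vector ℕ n → Vector M.D n → M.D → Set
  Represents ks ρ x = ∀ i a → opair (ι (key (ks i))) a ∈ ι x ↔ a ≡ ι (ρ i)

  update-unique : ∀ {x x′ z k y} → Update x z k y → Update x′ z k y → x ≡ x′
  update-unique (mkUpdate s) (mkUpdate s′) = ext λ p → ↔-trans (s p) (↔-sym (s′ p))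

  opaque
    -- The update formed in N is included in `x` enlarged by the new pair, a set of M, and so is
    -- itself in M.
    updateᴹ : ∀ x k y → Σ M.D λ x′ → Update (ι x′) (ι x) (ι k) (ι y)
    updateᴹ x k y = into (update (ι x) (ι k) (ι y))
      where
      bound : M.D
      bound = x M.∪ M.upair (M.opair k y) (M.opair k y)
      in-bound : ∀ {x′} → Update x′ (ι x) (ι k) (ι y) → x′ ⊆ ι bound
      in-bound (mkUpdate spec) p m =
        [ (λ e → subst (_∈ ι bound) (trans ι-opair (sym e)) (proj₁ ι-∈ (M.∪-right _ M.left∈upair)))
        , (λ (p∈x , _) → proj₁ ι-⊆ M.∪-left p p∈x) ] (proj₁ (spec p) m)
      into : (Σ D λ x′ → Update x′ (ι x) (ι k) (ι y)) → Σ M.D λ x′ → Update (ι x′) (ι x) (ι k) (ι y)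
      into (x′ , u) = let (x″ , e) = subset-InM (in-bound u) in x″ , subst (λ v → Update v (ι x) (ι k) (ι y)) (sym e) u

  represents-update : ∀ {ks : Vector ℕ n} {ρ x x′ m y} → (∀ i → ¬ ks i ≡ m) → Represents ks ρ x →
    Update (ι x′) (ι x) (ι (key m)) (ι y) → Represents (m ∷ ks) (y ∷ ρ) x′
  represents-update fresh r u zero    a = lookup-updated u a
  represents-update fresh r u (suc i) a =
    ↔-trans (lookup-other u (λ e → fresh i (key-injective _ _ (ι-injective e))) a) (r i a)

  opaque
    assignment : (ks : Vector ℕ n) → (∀ i j → ks i ≡ ks j → i ≡ j) → (ρ : Vector M.D n) → Σ M.D (Represents ks ρ)
    assignment {zero}  ks inj ρ = M.∅ , λ ()
    assignment {suc n} ks inj ρ =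
      let (x , r)  = assignment (tail ks) (λ i j e → Fin-suc-injective (inj (suc i) (suc j) e)) (tail ρ)
          (x′ , u) = updateᴹ x (key (ks zero)) (ρ zero)
          r′ = represents-update (λ i e → 0≢1+n (inj zero (suc i) (sym e))) r u
      in x′ , λ { zero → r′ zero ; (suc i) → r′ (suc i) }

  atomᴹ : M.D → M.D → M.D
  atomᴹ k l = M.opair M.∅ (M.opair k l)

  nexᴹ : M.D → M.D → M.D → M.D
  nexᴹ k d e = M.opair (M.upair M.∅ M.∅) (M.opair k (M.opair d e))

  ι-atomᴹ : ∀ {k l} → ι (atomᴹ k l) ≡ atomᶜ (ι k) (ι l)
  ι-atomᴹ = trans ι-opair (cong₂ opair ι-∅ ι-opair)

  ι-nexᴹ : ∀ {k d e} → ι (nexᴹ k d e) ≡ nexᶜ (ι k) (ι d) (ι e)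
  ι-nexᴹ = trans ι-opair (cong₂ opair (trans ι-upair (cong₂ upair ι-∅ ι-∅)) (trans ι-opair (cong (opair _) ι-opair)))

  nameᴹ : M.D → M.D → M.D → M.D → M.D
  nameᴹ k d e x = M.opair k (M.opair d (M.opair e x))

  ι-nameᴹ : ∀ {k d e x} → ι (nameᴹ k d e x) ≡ nameᶜ (ι k) (ι d) (ι e) (ι x)
  ι-nameᴹ = trans ι-opair (cong (opair _) (trans ι-opair (cong (opair _) ι-opair)))

  -- Truth in a good level agrees with truth in M

  module TruthOfM (g : D) (lg : Lev g) (g∉M : ¬ InM g) (good : Good g) where

    -- Only assignments from M are tested. For `P` the satisfaction of a formula in M, `correct`
    -- says that truth in `g` and truth in M agree on it.
    record Expresses (ks : Vector ℕ n) (P : Vector M.D n → Set) : Set where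
      constructor expresses
      field
        code    : M.D
        isCode  : Code (ι code)
        correct : ∀ ρ x → Represents ks ρ x → True g (ι code) (ι x) ↔ P ρ

    private
      variable
        ks : Vector ℕ n
        P Q : Vector M.D n → Set

    expresses-↔ : (∀ ρ → P ρ ↔ Q ρ) → Expresses ks P → Expresses ks Q
    expresses-↔ e (expresses c cc h) = expresses c cc λ ρ x r → ↔-trans (h ρ x r) (e ρ)

    expresses-weaken : ∀ {m} → Expresses ks P → Expresses (m ∷ ks) (λ ρ → P (tail ρ))
    expresses-weaken (expresses c cc h) = expresses c cc λ ρ x r → h (tail ρ) x (λ i → r (suc i))

    expresses-∈ : (i j : Fin n) → Expresses ks (λ ρ → ρ i M.∈ ρ j)
    expresses-∈ {ks = ks} i j = expresses (atomᴹ (key (ks i)) (key (ks j)))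
      (subst Code (sym ι-atomᴹ) (atom _ _)) λ ρ x r →
        ↔-trans (subst-↔ (λ c → True g c (ι x)) ι-atomᴹ) (↔-trans (true-atom (ι x))
          ((λ (_ , a , b , p , q , a∈b) → proj₂ ι-∈ (subst₂ _∈_ (proj₁ (r i a) p) (proj₁ (r j b) q) a∈b)) ,
           (λ m → new-level-contains-M lg g∉M x , ι (ρ i) , ι (ρ j) ,
                  proj₂ (r i _) refl , proj₂ (r j _) refl , proj₁ ι-∈ m)))

    -- The Tarski-Vaught criterion for assignments: goodness moves the updated assignment into M,
    -- and the new value follows as a component of a pair belonging to it.
    good-witness : ∀ {k d e x x′} → x′ ∈ g → Witness g (ι k) (ι d) (ι e) (ι x) x′ →
      Σ M.D λ x″ → (Σ M.D λ y → Update (ι x″) (ι x) (ι k) (ι y)) × True g (ι d) (ι x″) × True g (ι e) (ι x″)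
    good-witness {k} {d} {e} {x} {x′} x′∈g w =
      back (good (nameᴹ k d e x) x′ x′∈g (mkWitness ι-nameᴹ w))
      where
      value-in-M : ∀ {x″ y} → Update (ι x″) (ι x) (ι k) y → Σ M.D λ y → Update (ι x″) (ι x) (ι k) (ι y)
      value-in-M {x″} {y} u =
        let (y₀ , e) = InM-opairʳ (∈ι⇒InM (proj₂ (lookup-updated u y) refl)) in
        y₀ , subst (Update (ι x″) (ι x) (ι k)) (sym e) u
      back : Σ M.D (λ x″ → NamedWitness g (ι (nameᴹ k d e x)) (ι x″)) →
             Σ M.D λ x″ → (Σ M.D λ y → Update (ι x″) (ι x) (ι k) (ι y)) × True g (ι d) (ι x″) × True g (ι e) (ι x″)
      back (x″ , nw) =
        let ((_ , u) , td , te) = unname (subst (λ b → NamedWitness g b (ι x″)) ι-nameᴹ nw) in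
        x″ , value-in-M u , td , te

    -- The key `m` is fresh, so updating it preserves the free variables. A witness in M yields an
    -- updated assignment in M, hence in `g`; conversely `good-witness` brings a witness from `g`
    -- down to M.
    expresses-nex : ∀ {m} → (∀ i → ks i < m) → Expresses (m ∷ ks) P → Expresses (m ∷ ks) Q →
                    Expresses ks (λ ρ → ¬ Σ M.D λ y → P (y ∷ ρ) × Q (y ∷ ρ))
    expresses-nex {ks = ks} {P} {Q} {m} ks<m (expresses c cc hc) (expresses d cd hd) =
      expresses (nexᴹ (key m) c d) (subst Code (sym ι-nexᴹ) (nex _ cc cd)) λ ρ x r →
        ↔-trans (subst-↔ (λ c′ → True g c′ (ι x)) ι-nexᴹ) (↔-trans (true-nex cc cd (ι x))
          ((λ (_ , ¬w) (y , p , q) →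
              let (x′ , u) = updateᴹ x (key m) y
                  r′ = represents-update (λ i → <⇒≢ (ks<m i)) r u
              in ¬w (ι x′ , new-level-contains-M lg g∉M x′ , (ι y , u) ,
                     proj₂ (hc _ x′ r′) p , proj₂ (hd _ x′ r′) q)) ,
           (λ ¬y → new-level-contains-M lg g∉M x , λ (x′ , x′∈g , w) →
              let (x″ , (y , u) , tc , td) = good-witness x′∈g w
                  r′ = represents-update (λ i → <⇒≢ (ks<m i)) r u
              in ¬y (y , proj₁ (hc _ x″ r′) tc , proj₁ (hd _ x″ r′) td))))

    -- Negation through a dummy quantifier: `P` is repeated as both conjuncts and does not mention
    -- the bound variable, for which `M.∅` serves as a default value.
    expresses-¬ : ∀ {m} → (∀ i → ks i < m) → Expresses ks P → Expresses ks (λ ρ → ¬ P ρ)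
    expresses-¬ {P = P} ks<m p = expresses-↔ {P = λ ρ → ¬ Σ M.D λ _ → P ρ × P ρ}
      (λ ρ → (λ h x → h (M.∅ , x , x)) , (λ h (_ , x , _) → h x))
      (expresses-nex ks<m (expresses-weaken p) (expresses-weaken p))

    expresses-× : ∀ {m} → (∀ i → ks i < m) → Expresses ks P → Expresses ks Q → Expresses ks (λ ρ → P ρ × Q ρ)
    expresses-× {P = P} {Q} ks<m p q = expresses-↔ {P = λ ρ → ¬ ¬ Σ M.D λ _ → P ρ × Q ρ}
      (λ ρ → (λ h → by-contradiction λ ¬pq → h λ (_ , pq) → ¬pq pq) , (λ pq h → h (M.∅ , pq)))
      (expresses-¬ ks<m (expresses-nex ks<m (expresses-weaken p) (expresses-weaken q)))

    extend-< : ∀ {m} {ks : Vector ℕ n} → (∀ i → ks i < m) → ∀ i → (m ∷ ks) i < suc m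
    extend-< ks<m zero    = n<1+n _
    extend-< ks<m (suc i) = m<n⇒m<1+n (ks<m i)

    expresses-⊆ : ∀ {m} → (∀ i → ks i < m) → (i j : Fin n) →
                  Expresses ks (λ ρ → ¬ Σ M.D λ w → w M.∈ ρ i × ¬ w M.∈ ρ j)
    expresses-⊆ ks<m i j =
      expresses-nex ks<m (expresses-∈ zero (suc i)) (expresses-¬ (extend-< ks<m) (expresses-∈ zero (suc j)))

    -- External recursion on the formula, with `m` as the key of the next bound variable. Classical
    -- logic reduces every connective and quantifier to `nexᶜ`.
    expresses-Sat : ∀ {m} (ks : Vector ℕ n) → (∀ i → ks i < m) → (φ : Formula n) → Expresses ks (Sat 𝓜 φ)
    expresses-Sat ks ks<m (i ∈' j) = expresses-∈ i j
    -- Codes have no equality atom; extensionality turns equality into mutual inclusion.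
    expresses-Sat ks ks<m (i ≐ j) = expresses-↔
      (λ ρ → (λ (h , h′) → M.⊆-antisym
                (λ z m → by-contradiction λ z∉ → h (z , m , z∉)) (λ z m → by-contradiction λ z∉ → h′ (z , m , z∉))) ,
             (λ e → (λ (w , m , w∉) → w∉ (subst (w M.∈_) e m)) , (λ (w , m , w∉) → w∉ (subst (w M.∈_) (sym e) m))))
      (expresses-× ks<m (expresses-⊆ ks<m i j) (expresses-⊆ ks<m j i))
    -- Falsity is coded as the existence of a set that is a member of itself.
    expresses-Sat ks ks<m ⊥' = expresses-↔
      (λ ρ → (λ h → h λ (_ , m , _) → M.∈-irrefl m) , λ ())
      (expresses-¬ ks<m (expresses-nex ks<m (expresses-∈ zero zero) (expresses-∈ zero zero)))
    expresses-Sat ks ks<m (¬' φ) = expresses-¬ ks<m (expresses-Sat ks ks<m φ)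
    expresses-Sat ks ks<m (φ ∧' ψ) = expresses-× ks<m (expresses-Sat ks ks<m φ) (expresses-Sat ks ks<m ψ)
    expresses-Sat ks ks<m (φ ∨' ψ) = expresses-↔
      (λ ρ → (λ h → by-contradiction λ ¬s → h ((λ p → ¬s (inj₁ p)) , (λ q → ¬s (inj₂ q)))) ,
             (λ s (¬p , ¬q) → [ ¬p , ¬q ] s))
      (expresses-¬ ks<m (expresses-× ks<m (expresses-¬ ks<m (expresses-Sat ks ks<m φ))
                                          (expresses-¬ ks<m (expresses-Sat ks ks<m ψ))))
    expresses-Sat ks ks<m (φ ⇒' ψ) = expresses-↔
      (λ ρ → (λ h p → by-contradiction λ ¬q → h (p , ¬q)) , (λ f (p , ¬q) → ¬q (f p)))
      (expresses-¬ ks<m (expresses-× ks<m (expresses-Sat ks ks<m φ) (expresses-¬ ks<m (expresses-Sat ks ks<m ψ))))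
    expresses-Sat {m = m} ks ks<m (∀' φ) = expresses-↔
      (λ ρ → (λ h x → by-contradiction λ ¬p → h (x , ¬p , ¬p)) , (λ h (x , ¬p , _) → ¬p (h x)))
      (expresses-nex ks<m ¬φ ¬φ)
      where
      ¬φ : Expresses (m ∷ ks) (λ ρ → ¬ Sat 𝓜 φ ρ)
      ¬φ = expresses-¬ (extend-< ks<m) (expresses-Sat (m ∷ ks) (extend-< ks<m) φ)
    expresses-Sat {m = m} ks ks<m (∃' φ) = expresses-↔
      (λ ρ → (λ h → by-contradiction λ ¬s → h λ (x , p , _) → ¬s (x , p)) , (λ (x , p) h → h (x , p , p)))
      (expresses-¬ ks<m (expresses-nex ks<m φ′ φ′))
      where
      φ′ : Expresses (m ∷ ks) (Sat 𝓜 φ)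
      φ′ = expresses-Sat (m ∷ ks) (extend-< ks<m) φ

    -- Undefinability of truth

    -- Tarski's diagonal class: a formula with parameters is evaluated at the very pair `z` that
    -- codes it. The key `∅` is reserved for this argument.
    Diagonal : D → Set
    Diagonal z = Σ D λ c → Σ D λ p → Σ D λ x → z ≡ opair c p × Update x p ∅ z × ¬ True g c x

    contradiction : ⊥
    contradiction = refute (conservative₁ Diagonal it)
      where
      refute : ¬ M.Def₁ (λ z → Diagonal (ι z))
      refute (M.mkDef {m} ψ q d) = ¬sat (proj₂ diagonal-↔ (in-diagonal ¬sat))
        where
        keys : Vector ℕ (suc m)
        -- The free variable of `ψ` receives the key `∅` that `Diagonal` updates; the shift by one
        -- keeps the parameters away from it.
        keys = zero ∷ λ i → suc (toℕ i)
        keys< : ∀ i → keys i < suc m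
        keys< zero    = s≤s z≤n
        keys< (suc i) = s≤s (toℕ<n i)
        ψᶜ : Expresses keys (Sat 𝓜 ψ)
        ψᶜ = expresses-Sat keys keys< ψ
        open Expresses ψᶜ
        params : Σ M.D (Represents (tail keys) q)
        params = assignment (tail keys) (λ i j e → toℕ-injective (suc-injective e)) q
        z : M.D
        z = M.opair code (proj₁ params)
        updated : Σ M.D λ x → Update (ι x) (ι (proj₁ params)) (ι M.∅) (ι z)
        updated = updateᴹ (proj₁ params) M.∅ z
        isUpdate : Update (ι (proj₁ updated)) (ι (proj₁ params)) ∅ (ι z)
        isUpdate = subst (λ e → Update (ι (proj₁ updated)) (ι (proj₁ params)) e (ι z)) ι-∅ (proj₂ updated)
        truth : True g (ι code) (ι (proj₁ updated)) ↔ Sat 𝓜 ψ (z ∷ q)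
        truth = correct (z ∷ q) (proj₁ updated)
          λ { zero → r zero ; (suc i) → r (suc i) }
          where
          r : Represents (zero ∷ tail keys) (z ∷ q) (proj₁ updated)
          r = represents-update (λ i ()) (proj₂ params) (proj₂ updated)
        diagonal-↔ : Sat 𝓜 ψ (z ∷ q) ↔ Diagonal (ι z)
        diagonal-↔ = ↔-sym (d (λ _ → z))
        in-diagonal : ¬ Sat 𝓜 ψ (z ∷ q) → Diagonal (ι z)
        in-diagonal ¬s = ι code , ι (proj₁ params) , ι (proj₁ updated) , ι-opair ,
          isUpdate , λ t → ¬s (proj₁ truth t)
        not-diagonal : Diagonal (ι z) → ¬ Sat 𝓜 ψ (z ∷ q)
        not-diagonal (c , p , x , e , u , ¬t) s with opair-inj (trans (sym ι-opair) e)
        -- Updates are unique, so the assignment inside `Diagonal` is the one for which `truth` was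
        -- established.
        ... | refl , refl = ¬t (subst (True g (ι code))
          (update-unique isUpdate u) (proj₂ truth s))
        ¬sat : ¬ Sat 𝓜 ψ (z ∷ q)
        ¬sat s = not-diagonal (proj₁ diagonal-↔ s) s

theorem5p1 : ExcludedMiddle →
    (𝓜 𝓝 : Structure) → IsZF 𝓜 → IsZF 𝓝 →
    (ι : Dom 𝓜 → Dom 𝓝) →
    IsEndExtension 𝓜 𝓝 ι → IsProper 𝓜 𝓝 ι → IsConservative 𝓜 𝓝 ι → ⊥
theorem5p1 em 𝓜 𝓝 zfᴹ zfᴺ ι end proper conservative =
  let (g , lg , g∉M , good) = good-level-exists proper in TruthOfM.contradiction g lg g∉M good
  where open ConservativeEndExtension em 𝓜 𝓝 zfᴹ zfᴺ ι end conservative
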